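{- There exists an atomless, complete, $\sigma$-centered Boolean algebra which has no countable regular subalgebra if and only if there exists a non-principal nowhere dense ultrafilter on $\omega$.
   Context: A subalgebra $\mathbb{B}$ of a Boolean algebra $\mathbb{A}$ is regular if for every $X\subseteq\mathbb{B}$, $\sup_{\mathbb{B}}X=\mathbf{1}$ implies $\sup_{\mathbb{A}}X=\mathbf{1}$. A Boolean algebra $\mathbb{B}$ is $\sigma$-centered if $\mathbb{B}\setminus\{\mathbf{0}\}$ is the union of countably many centered families, where a family is centered if every finite subfamily has non-zero meet. A filter $D$ on $\omega$ is nowhere dense if for every function $f\colon\omega\to{}^\omega 2$ (the Cantor set) there is $A\in D$ such that $f(A)$ is nowhere dense in ${}^\omega 2$.
   Formalization: "No countable regular subalgebra" is proved as "no countable atomless regular subalgebra": read literally the left side never holds, since {0,1} is always a countable regular subalgebra, while non-principal nowhere dense ultrafilters exist under CH. -}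

module Defs where

open import Algebra.Lattice.Bundles using (BooleanAlgebra)
import Algebra.Lattice.Properties.Lattice as LatticeProperties
open import Data.Bool.Base using (Bool)
open import Data.List.Base using (List; foldr)
open import Data.List.Relation.Unary.All using (All)
open import Data.Nat.Base using (ℕ; _<_)
open import Data.Product.Base using (Σ-syntax; ∃-syntax; _×_)
open import Data.Sum.Base using (_⊎_)
open import Function.Bundles using (Func; Surjection; _⇔_)
open import Function.Definitions using (StrictlyInverseˡ)
open import Level using (Level; 0ℓ; suc; _⊔_)
open import Relation.Binary.Bundles using (Poset; Setoid)
open import Relation.Binary.Definitions using (_Respects_)
open import Relation.Binary.PropositionalEquality.Core using (_≡_; _≗_)
open import Relation.Nullary.Negation.Core using (¬_)
open import Relation.Unary using (Pred; _∈_; _⊆_; _∩_; ∁; U; ∅; Empty)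

-- The axiom of choice, as "every surjection has a section".  The Σ-type in
-- the definition of Surjection already yields a function picking preimages;
-- what the axiom adds is that the choice respects the setoid equalities.
AxiomOfChoice : ∀ a ℓ → Set (suc (a ⊔ ℓ))
AxiomOfChoice a ℓ =
  (A B : Setoid a ℓ) (f : Surjection A B) →
  Σ[ g ∈ Func B A ]
    StrictlyInverseˡ (Setoid._≈_ B) (Surjection.to f) (Func.to g)

module _ (𝔸 : BooleanAlgebra 0ℓ 0ℓ) where

  open BooleanAlgebra 𝔸 renaming (¬_ to −_)
  open Poset (LatticeProperties.poset lattice) using (_≤_)

  Nontrivial : Set
  Nontrivial = ⊤ ≉ ⊥

  record IsSubalgebra (B : Pred Carrier 0ℓ) : Set where
    field
      resp     : B Respects _≈_
      ⊤-closed : ⊤ ∈ B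
      ⊥-closed : ⊥ ∈ B
      ∨-closed : ∀ {x y} → x ∈ B → y ∈ B → (x ∨ y) ∈ B
      ∧-closed : ∀ {x y} → x ∈ B → y ∈ B → (x ∧ y) ∈ B
      −-closed : ∀ {x} → x ∈ B → (− x) ∈ B

  -- s is the supremum of X computed in B (with the order inherited from 𝔸).
  record IsSup (B X : Pred Carrier 0ℓ) (s : Carrier) : Set where
    field
      member : s ∈ B
      upper  : ∀ {x} → x ∈ X → x ≤ s
      least  : ∀ {b} → b ∈ B → (∀ {x} → x ∈ X → x ≤ b) → s ≤ b

  Complete : Set₁
  Complete = (X : Pred Carrier 0ℓ) → ∃[ s ] IsSup U X s

  Regular : Pred Carrier 0ℓ → Set₁
  Regular B = (X : Pred Carrier 0ℓ) → X ⊆ B → IsSup B X ⊤ → IsSup U X ⊤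

  record IsAtom (B : Pred Carrier 0ℓ) (a : Carrier) : Set where
    field
      member  : a ∈ B
      nonzero : a ≉ ⊥
      minimal : ∀ {b} → b ∈ B → b ≤ a → b ≈ ⊥ ⊎ b ≈ a

  Atomless : Pred Carrier 0ℓ → Set
  Atomless B = Empty (IsAtom B)

  -- For nonempty B, such as a subalgebra; finite sets count as countable.
  Countable : Pred Carrier 0ℓ → Set
  Countable B =
    Σ[ e ∈ (ℕ → Carrier) ]
      (∀ n → e n ∈ B) × (∀ {b} → b ∈ B → ∃[ n ] e n ≈ b)

  -- Atomlessness of the subalgebra has to be explicit: {⊥, ⊤} is always a
  -- countable regular subalgebra, and so is, in an atomless complete algebra,
  -- the infinite one of finite and cofinite joins of a countably infinite
  -- partition of ⊤.
  HasCountableRegularSubalgebra : Set₁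
  HasCountableRegularSubalgebra =
    Σ[ B ∈ Pred Carrier 0ℓ ]
      IsSubalgebra B × Atomless B × Countable B × Regular B

  Centered : Pred Carrier 0ℓ → Set
  Centered C = (xs : List Carrier) → All C xs → foldr _∧_ ⊤ xs ≉ ⊥

  σ-Centered : Set₁
  σ-Centered =
    Σ[ C ∈ (ℕ → Pred Carrier 0ℓ) ]
      (∀ n → Centered (C n)) × (∀ x → x ≉ ⊥ ⇔ (∃[ n ] x ∈ C n))

Cantor : Set
Cantor = ℕ → Bool

-- The basic clopen neighbourhood of x given by its first n values.
Nbhd : Cantor → ℕ → Pred Cantor 0ℓ
Nbhd x n y = ∀ i → i < n → x i ≡ y i

closure : Pred Cantor 0ℓ → Pred Cantor 0ℓ
closure Y x = ∀ n → ∃[ y ] (y ∈ Nbhd x n × y ∈ Y)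

interior : Pred Cantor 0ℓ → Pred Cantor 0ℓ
interior Y x = ∃[ n ] Nbhd x n ⊆ Y

NowhereDense : Pred Cantor 0ℓ → Set
NowhereDense Y = Empty (interior (closure Y))

image : (ℕ → Cantor) → Pred ℕ 0ℓ → Pred Cantor 0ℓ
image f A y = ∃[ n ] (n ∈ A × f n ≗ y)

record IsUltrafilter (D : Pred (Pred ℕ 0ℓ) 0ℓ) : Set₁ where
  field
    U∈D        : U ∈ D
    ∅∉D        : ¬ (∅ ∈ D)
    upward     : ∀ {A B} → A ⊆ B → A ∈ D → B ∈ D
    ∩-closed   : ∀ {A B} → A ∈ D → B ∈ D → (A ∩ B) ∈ D
    ultra      : ∀ A → A ∈ D ⊎ ∁ A ∈ D

Principal : Pred (Pred ℕ 0ℓ) 0ℓ → Set₁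
Principal D = Σ[ X ∈ Pred ℕ 0ℓ ] (∀ A → A ∈ D ⇔ X ⊆ A)

NowhereDenseFilter : Pred (Pred ℕ 0ℓ) 0ℓ → Set₁
NowhereDenseFilter D =
  (f : ℕ → Cantor) → Σ[ A ∈ Pred ℕ 0ℓ ] (A ∈ D × NowhereDense (image f A))

{-# OPTIONS --safe #-}
module Submission where

-- (⇒) Extend the centered families of 𝔸 to ultrafilters pₙ, so that x ≉ ⊥ iff x lies in some pₙ. If no
-- nonprincipal ultrafilter on ω is nowhere dense, then neither is the one that pₙ induces on ω through a
-- partition of ⊤ whose cells are not in pₙ; the witnessing map ω → ω2 is a name rₙ for a real all of whose
-- traces on elements of pₙ are somewhere dense. Call an element rₙ-sparse if its rₙ-trace is nowhere dense
-- and disjointify one rₙ-sparse element from each ultrafilter that has any. Keeping rₙ outside these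
-- cells, and on the k-th cell k + 1 bits of rₙ followed by the real obtained in the same way from
-- rₙ₊₁, rₙ₊₂, …, yields from r₀ a real with somewhere dense trace on every nonzero element: a Cohen real.
-- The elements decided by finitely many of its bits form the countable regular subalgebra.
--
-- (⇐) 𝔸 is the algebra of clopen subsets of the finite sequences over ω, where V is open iff s ∈ V implies
-- s⌢n ∈ V for D-almost all n. A countable atomless subalgebra has a dense binary tree, which maps the space
-- continuously to ω2. As D is nowhere dense, some open set around the root has nowhere dense image, so the
-- elements of the subalgebra disjoint from it have supremum ⊤ in the subalgebra but not in 𝔸.

open import Defs
open import Algebra.Lattice.Bundles using (BooleanAlgebra)
import Algebra.Lattice.Properties.BooleanAlgebra as BooleanAlgebraProperties
import Algebra.Lattice.Properties.Lattice as LatticeProperties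
open import Axiom.ExcludedMiddle using (ExcludedMiddle)
import Data.Bool.Base as Bool
open import Data.Bool.Base using (Bool; true; false; T; not)
import Data.Bool.Properties as Boolₚ
open import Data.Bool.Properties using (T-∧; T-∨; ¬-not; not-¬)
open import Data.List.Base using (List; []; _∷_; _++_; length; filter; foldr; map)
open import Data.List.Membership.Propositional using () renaming (_∈_ to _∈ˡ_)
open import Data.List.Membership.Propositional.Properties using (∈-++⁺ˡ; ∈-++⁺ʳ; ∈-map⁺; ∈-filter⁺; ∈-filter⁻)
open import Data.List.Properties using (∷-injectiveˡ; ∷-injectiveʳ; ++-assoc; length-++)
import Data.List.Relation.Unary.All as All
open import Data.List.Relation.Unary.All using (All; []; _∷_)
open import Data.List.Relation.Unary.All.Properties using (++⁺)
open import Data.List.Relation.Unary.Any using (here; there)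
open import Data.Nat.Base using (ℕ; zero; suc; _+_; _<_; _≤_; _≡ᵇ_; z≤n; s≤s)
open import Data.Nat.Properties
open import Data.Product.Base using (Σ-syntax; ∃-syntax; ∃; _×_; _,_; proj₁; proj₂)
open import Data.Sum.Base using (_⊎_; inj₁; inj₂; [_,_]′)
open import Function.Base using (_∘_; id; case_of_)
open import Function.Bundles using (Func; Surjection; Equivalence; _⇔_; mk⇔; _↠_; mk↠ₛ)
open import Function.Construct.Identity using (↠-id)
open import Level using (0ℓ)
open import Relation.Binary.Bundles using (Poset; Setoid)
open import Relation.Binary.Lattice using (MeetSemilattice)
open import Relation.Binary.PropositionalEquality using (_≡_; _≢_; _≗_; refl; sym; trans; cong; cong₂; subst)
open import Relation.Nullary.Decidable.Core using (Dec; yes; no; isYes; toWitness; fromWitness; decidable-stable)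
open import Relation.Nullary.Negation.Core using (¬_; contradiction)
open import Relation.Unary using (Pred; _∈_; _⊆_; _∩_; ∁; U; ∅)

-- Enumerations of pairs and lists.

diagonal : ℕ × ℕ → ℕ × ℕ
diagonal (zero , b) = suc b , zero
diagonal (suc a , b) = a , suc b

unpair : ℕ → ℕ × ℕ
unpair zero = zero , zero
unpair (suc n) = diagonal (unpair n)

-- `diagonal` runs through each antidiagonal from `(s , 0)` to `(0 , s)`, so a pair is reached by
-- stepping back to its predecessor.
unpair-surjective : ∀ s b a → a + b ≡ s → ∃[ n ] unpair n ≡ (a , b)
unpair-surjective s (suc b) a eq with unpair-surjective s b (suc a) (trans (sym (+-suc a b)) eq)
... | n , p = suc n , cong diagonal p
unpair-surjective zero zero zero eq = zero , refl
unpair-surjective (suc s) zero (suc a) eq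
  with unpair-surjective s a zero (trans (sym (+-identityʳ a)) (suc-injective eq))
... | n , p = suc n , cong diagonal p

ℕ↠ℕ×ℕ : ℕ ↠ (ℕ × ℕ)
ℕ↠ℕ×ℕ = mk↠ₛ {to = unpair} λ (a , b) → unpair-surjective (a + b) b a refl

module _ {A : Set} (e : ℕ ↠ A) where

  open Surjection e using (to; to⁻; to∘to⁻)

  decodeList : ℕ → ℕ → List A
  decodeList zero c = []
  decodeList (suc l) c = to (proj₁ (unpair c)) ∷ decodeList l (proj₂ (unpair c))

  decodeList-surjective : ∀ xs → ∃[ c ] decodeList (length xs) c ≡ xs
  decodeList-surjective [] = zero , refl
  decodeList-surjective (x ∷ xs) with decodeList-surjective xs
  ... | c , eq with Surjection.strictlySurjective ℕ↠ℕ×ℕ (to⁻ x , c)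
  ... | d , p = d , cong₂ _∷_ (trans (cong (to ∘ proj₁) p) (to∘to⁻ x))
                              (trans (cong (decodeList (length xs) ∘ proj₂) p) eq)

  abstract
    ↠List : ℕ ↠ List A
    ↠List = mk↠ₛ {to = λ n → decodeList (proj₁ (unpair n)) (proj₂ (unpair n))} surj
      where
      surj : ∀ xs → ∃[ n ] decodeList (proj₁ (unpair n)) (proj₂ (unpair n)) ≡ xs
      surj xs with decodeList-surjective xs
      ... | c , eq with Surjection.strictlySurjective ℕ↠ℕ×ℕ (length xs , c)
      ... | n , p = n , trans (cong (λ q → decodeList (proj₁ q) (proj₂ q)) p) eq

ℕ↠Bool : ℕ ↠ Bool
ℕ↠Bool = mk↠ₛ {to = λ n → n ≡ᵇ 0} λ { true → 0 , refl ; false → 1 , refl }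

-- Finite strings as neighbourhoods in the Cantor set.

-- Finite strings carry the most recent bit at the head, so w ++ s extends s.
restrict : Cantor → ℕ → List Bool
restrict x zero = []
restrict x (suc n) = x n ∷ restrict x n

Through : Cantor → List Bool → Set
Through x s = restrict x (length s) ≡ s

length-restrict : ∀ x n → length (restrict x n) ≡ n
length-restrict x zero = refl
length-restrict x (suc n) = cong suc (length-restrict x n)

restrict-Through : ∀ x n → Through x (restrict x n)
restrict-Through x n = cong (restrict x) (length-restrict x n)

Nbhd⇒restrict : ∀ {x y} n → y ∈ Nbhd x n → restrict x n ≡ restrict y n
Nbhd⇒restrict zero p = refl
Nbhd⇒restrict (suc n) p = cong₂ _∷_ (p n ≤-refl) (Nbhd⇒restrict n λ i i<n → p i (m≤n⇒m≤1+n i<n))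

restrict⇒Nbhd : ∀ {x y} n → restrict x n ≡ restrict y n → y ∈ Nbhd x n
restrict⇒Nbhd (suc n) eq i (s≤s i≤n) with m≤n⇒m<n∨m≡n i≤n
... | inj₁ i<n = restrict⇒Nbhd n (∷-injectiveʳ eq) i i<n
... | inj₂ refl = ∷-injectiveˡ eq

Nbhd-≤ : ∀ {x y m n} → m ≤ n → y ∈ Nbhd x n → y ∈ Nbhd x m
Nbhd-≤ m≤n p i i<m = p i (<-≤-trans i<m m≤n)

Nbhd-Through : ∀ {x y s} → y ∈ Nbhd x (length s) → Through x s → Through y s
Nbhd-Through {s = s} p x∋s = trans (sym (Nbhd⇒restrict (length s) p)) x∋s

Through⇒Nbhd : ∀ {x y} s → Through x s → Through y s → y ∈ Nbhd x (length s)
Through⇒Nbhd s x∋s y∋s = restrict⇒Nbhd (length s) (trans x∋s (sym y∋s))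

Through-suffix : ∀ {x} w {s} → Through x (w ++ s) → Through x s
Through-suffix [] p = p
Through-suffix (v ∷ w) p = Through-suffix w (∷-injectiveʳ p)

restrict-+ : ∀ x k n → ∃[ w ] restrict x (k + n) ≡ w ++ restrict x n
restrict-+ x zero n = [] , refl
restrict-+ x (suc k) n with restrict-+ x k n
... | w , eq = x (k + n) ∷ w , cong (x (k + n) ∷_) eq

Through-extend : ∀ {x} k s → Through x s → ∃[ w ] restrict x (k + length s) ≡ w ++ s
Through-extend {x} k s x∋s with restrict-+ x k (length s)
... | w , eq = w , trans eq (cong (w ++_) x∋s)

Through-++ : ∀ {x z} u t → Through x u → (∀ i → x (i + length u) ≡ z i) →
             Through z t → Through x (t ++ u)
Through-++ u [] x∋u eq z∋t = x∋u
Through-++ {x} u (v ∷ t) x∋u eq z∋t =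
  cong₂ _∷_ (trans (cong x (length-++ t)) (trans (eq (length t)) (∷-injectiveˡ z∋t)))
            (Through-++ u t x∋u eq (∷-injectiveʳ z∋t))

pad : List Bool → Cantor
pad [] i = false
pad (v ∷ s) i with i ≟ length s
... | yes _ = v
... | no _ = pad s i

pad-Through : ∀ s → Through (pad s) s
pad-Through [] = refl
pad-Through (v ∷ s) = cong₂ _∷_ head (trans (sym (Nbhd⇒restrict (length s) tail)) (pad-Through s))
  where
  head : pad (v ∷ s) (length s) ≡ v
  head with length s ≟ length s
  ... | yes _ = refl
  ... | no ≢ = contradiction refl ≢
  tail : pad (v ∷ s) ∈ Nbhd (pad s) (length s)
  tail i i<l with i ≟ length s
  ... | yes refl = contradiction i<l (<-irrefl refl)
  ... | no _ = refl

-- Nowhere dense sets through strings.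

-- Nowhere density and its negation in terms of finite strings.
Sparse : Pred Cantor 0ℓ → Set
Sparse Y = ∀ s → ∃[ w ] (∀ {y} → y ∈ Y → ¬ Through y (w ++ s))

SomewhereDense : Pred Cantor 0ℓ → Set
SomewhereDense Y = ∃[ s ] (∀ w → ∃[ y ] (y ∈ Y × Through y (w ++ s)))

sparse⇒¬somewhereDense : ∀ {Y} → Sparse Y → ¬ SomewhereDense Y
sparse⇒¬somewhereDense sparse (s , dense) with sparse s
... | w , avoid with dense w
... | y , y∈Y , y∋ = avoid y∈Y y∋

sparse-⊆ : ∀ {Y Z} → Y ⊆ Z → Sparse Z → Sparse Y
sparse-⊆ Y⊆Z sparse s = proj₁ (sparse s) , λ y∈Y → proj₂ (sparse s) (Y⊆Z y∈Y)

-- The string is lengthened once for each set in turn; what has been avoided stays avoided under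
-- further extension.
sparse-finite : ∀ {Y : ℕ → Pred Cantor 0ℓ} → (∀ k → Sparse (Y k)) →
  ∀ l s → ∃[ w ] (∀ {k y} → k < l → y ∈ Y k → ¬ Through y (w ++ s))
sparse-finite sparse zero s = [] , λ ()
sparse-finite {Y} sparse (suc l) s with sparse-finite sparse l s
... | w , avoid with sparse l (w ++ s)
... | w′ , avoid′ = w′ ++ w , avoids
  where
  avoids : ∀ {k y} → k < suc l → y ∈ Y k → ¬ Through y ((w′ ++ w) ++ s)
  avoids {y = y} (s≤s k≤l) y∈ y∋ with subst (Through y) (++-assoc w′ w s) y∋ | m≤n⇒m<n∨m≡n k≤l
  ... | y∋′ | inj₁ k<l = avoid k<l y∈ (Through-suffix w′ y∋′)
  ... | y∋′ | inj₂ refl = avoid′ y∈ y∋′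

sparse⇒nowhereDense : ∀ {Y} → Sparse Y → NowhereDense Y
sparse⇒nowhereDense sparse x (n , sub) with sparse (restrict x n)
... | w , avoid with sub {pad (w ++ restrict x n)} inside (length (w ++ restrict x n))
  where
  inside : pad (w ++ restrict x n) ∈ Nbhd x n
  inside = subst (λ m → pad (w ++ restrict x n) ∈ Nbhd x m) (length-restrict x n)
    (Through⇒Nbhd (restrict x n) (restrict-Through x n) (Through-suffix w (pad-Through (w ++ restrict x n))))
... | y , near , y∈Y = avoid y∈Y (Nbhd-Through near (pad-Through (w ++ restrict x n)))

nowhereDense⇒¬somewhereDense : ∀ {Y} → NowhereDense Y → ¬ SomewhereDense Y
nowhereDense⇒¬somewhereDense {Y} nwd (s , dense) with dense []
... | x , _ , x∋s = nwd x (length s , λ {z} → inClosure {z})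
  where
  inClosure : Nbhd x (length s) ⊆ closure Y
  -- Density below `s` concerns only extensions of `s`, so `z` is approximated on `m + length s`
  -- bits, at least the `m` required.
  inClosure {z} near m with Through-extend m s (Nbhd-Through near x∋s)
  ... | w , eq with dense w
  ... | y , y∈Y , y∋ = y , Nbhd-≤ (m≤m+n m (length s)) (restrict⇒Nbhd (m + length s) agree) , y∈Y
    where
    len : length (w ++ s) ≡ m + length s
    len = trans (cong length (sym eq)) (length-restrict z _)
    agree : restrict z (m + length s) ≡ restrict y (m + length s)
    agree = trans eq (trans (sym y∋) (cong (restrict y) len))

-- Classical reasoning with Boolean truth values.

module Classical (em : ∀ ℓ → ExcludedMiddle ℓ) where

  decide : ∀ {ℓ} (P : Set ℓ) → Dec P
  decide P = em _

  truth : ∀ {ℓ} → Set ℓ → Bool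
  truth P = isYes (decide P)

  truth⁺ : ∀ {ℓ} {P : Set ℓ} → P → T (truth P)
  truth⁺ = fromWitness

  truth⁻ : ∀ {ℓ} {P : Set ℓ} → T (truth P) → P
  truth⁻ = toWitness

  truth-true : ∀ {ℓ} {P : Set ℓ} → P → truth P ≡ true
  truth-true {P = P} p with decide P
  ... | yes _ = refl
  ... | no ¬p = contradiction p ¬p

  truth-false : ∀ {ℓ} {P : Set ℓ} → ¬ P → truth P ≡ false
  truth-false {P = P} ¬p with decide P
  ... | yes p = contradiction p ¬p
  ... | no _ = refl

  true-truth : ∀ {ℓ} {P : Set ℓ} → truth P ≡ true → P
  true-truth {P = P} eq with decide P
  ... | yes p = p

  false-truth : ∀ {ℓ} {P : Set ℓ} → truth P ≡ false → ¬ P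
  false-truth {P = P} eq with decide P
  ... | no ¬p = ¬p

  truth-cong : ∀ {ℓ ℓ′} {P : Set ℓ} {Q : Set ℓ′} → (P → Q) → (Q → P) → truth P ≡ truth Q
  truth-cong {P = P} f g with decide P
  ... | yes p = sym (truth-true (f p))
  ... | no ¬p = sym (truth-false (¬p ∘ g))

  by-contradiction : ∀ {ℓ} {P : Set ℓ} → ¬ ¬ P → P
  by-contradiction = decidable-stable (decide _)

  ¬∀⇒∃¬ : ∀ {a p} {A : Set a} {P : A → Set p} → ¬ (∀ x → P x) → ∃[ x ] ¬ P x
  ¬∀⇒∃¬ ¬∀ = by-contradiction λ ¬∃ → ¬∀ λ x → by-contradiction λ ¬p → ¬∃ (x , ¬p)

  ¬sparse⇒somewhereDense : ∀ {Y} → ¬ Sparse Y → SomewhereDense Y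
  ¬sparse⇒somewhereDense ¬sparse with ¬∀⇒∃¬ ¬sparse
  ... | s , none = s , λ w → by-contradiction λ ¬∃ → none (w , λ y∈Y y∋ → ¬∃ (_ , y∈Y , y∋))

  nowhereDense⇒sparse : ∀ {Y} → NowhereDense Y → Sparse Y
  nowhereDense⇒sparse nwd =
    by-contradiction (nowhereDense⇒¬somewhereDense nwd ∘ ¬sparse⇒somewhereDense)

-- Maximal families by a tower of one-element extensions.

module Tower (em : ∀ ℓ → ExcludedMiddle ℓ) (ac : ∀ a ℓ → AxiomOfChoice a ℓ) {A : Set}
  (Addable : (A → Bool) → A → Set)
  (Addable-antitone : ∀ {F G x} → (∀ y → T (F y) → T (G y)) → Addable G x → Addable F x) where

  open Classical em

  infix 4 _⊑_

  _⊑_ : (A → Bool) → (A → Bool) → Set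
  F ⊑ G = ∀ x → T (F x) → T (G x)

  ⊑-trans : ∀ {F G H} → F ⊑ G → G ⊑ H → F ⊑ H
  ⊑-trans p q x = q x ∘ p x

  Candidate : (A → Bool) → Set
  Candidate F = ∃[ x ] (Addable F x × ¬ T (F x))

  private

    -- The same family can be given by different functions and with different candidates. Equating
    -- families by mutual inclusion here, and in `pointed` also their candidates, makes a section of
    -- `forget` a choice that depends on the family alone.
    extensible : Setoid 0ℓ 0ℓ
    extensible = record
      { Carrier = Σ[ F ∈ (A → Bool) ] Candidate F
      ; _≈_ = λ (F , _) (G , _) → F ⊑ G × G ⊑ F
      ; isEquivalence = record
        { refl = (λ _ → id) , (λ _ → id)
        ; sym = λ (p , q) → q , p
        ; trans = λ (p , q) (p′ , q′) → (λ x → p′ x ∘ p x) , (λ x → q x ∘ q′ x)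
        }
      }

    pointed : Setoid 0ℓ 0ℓ
    pointed = record
      { Carrier = Σ[ F ∈ (A → Bool) ] Candidate F
      ; _≈_ = λ (F , x , _) (G , y , _) → x ≡ y × F ⊑ G × G ⊑ F
      ; isEquivalence = record
        { refl = refl , (λ _ → id) , (λ _ → id)
        ; sym = λ (e , p , q) → sym e , q , p
        ; trans = λ (e , p , q) (e′ , p′ , q′) → trans e e′ , (λ x → p′ x ∘ p x) , (λ x → q x ∘ q′ x)
        }
      }

    forget : Surjection pointed extensible
    forget = record { to = id ; cong = proj₂ ; surjective = λ c → c , proj₂ }

    section : Func extensible pointed
    section = proj₁ (ac _ _ pointed extensible forget)

    section-inverse : ∀ c → proj₁ (Func.to section c) ⊑ proj₁ c × proj₁ c ⊑ proj₁ (Func.to section c)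
    section-inverse = proj₂ (ac _ _ pointed extensible forget)

  choose : ∀ F → Candidate F → A
  choose F c = proj₁ (proj₂ (Func.to section (F , c)))

  choose-addable : ∀ F c → Addable F (choose F c)
  choose-addable F c =
    Addable-antitone (proj₂ (section-inverse (F , c))) (proj₁ (proj₂ (proj₂ (Func.to section (F , c)))))

  choose-new : ∀ F c → ¬ T (F (choose F c))
  choose-new F c =
    proj₂ (proj₂ (proj₂ (Func.to section (F , c)))) ∘ proj₂ (section-inverse (F , c)) _

  choose-cong : ∀ F G c d → F ⊑ G → G ⊑ F → choose F c ≡ choose G d
  choose-cong F G c d p q = proj₁ (Func.cong section {F , c} {G , d} (p , q))

  -- Without a candidate the second alternative is empty, so a family that admits none is left as it
  -- is.
  extend : (A → Bool) → A → Bool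
  extend F x = truth (T (F x) ⊎ (Σ[ c ∈ Candidate F ] x ≡ choose F c))

  ⋃ : ((A → Bool) → Bool) → A → Bool
  ⋃ S x = truth (∃[ F ] (T (S F) × T (F x)))

  ⊑-extend : ∀ F → F ⊑ extend F
  ⊑-extend F x = truth⁺ ∘ inj₁

  ⊑-⋃ : ∀ S {F} → T (S F) → F ⊑ ⋃ S
  ⊑-⋃ S F∈S x x∈F = truth⁺ (_ , F∈S , x∈F)

  ⋃-⊑ : ∀ S {G} → (∀ F → T (S F) → F ⊑ G) → ⋃ S ⊑ G
  ⋃-⊑ S bound x x∈ with truth⁻ x∈
  ... | F , F∈S , x∈F = bound F F∈S x x∈F

  extend-cong : ∀ {F G} → F ⊑ G → G ⊑ F → extend F ⊑ extend G
  extend-cong {F} {G} p q x x∈ with truth⁻ x∈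
  ... | inj₁ x∈F = truth⁺ (inj₁ (p x x∈F))
  ... | inj₂ (c , refl) = truth⁺ (inj₂ (d , choose-cong F G c d p q))
    where
    d : Candidate G
    d = proj₁ c , Addable-antitone q (proj₁ (proj₂ c)) , proj₂ (proj₂ c) ∘ q (proj₁ c)

  -- extend F has at most one element outside F.
  extend-cover : ∀ {F G} → F ⊑ G → G ⊑ extend F → ¬ G ⊑ F → extend F ⊑ G
  extend-cover {F} {G} F⊑G G⊑ G⋢F x x∈ with ¬∀⇒∃¬ G⋢F | truth⁻ x∈
  ... | _ | inj₁ x∈F = F⊑G x x∈F
  ... | y , y∉ | inj₂ (c , refl) with by-contradiction {P = T (G y)} (λ y∉G → y∉ λ y∈G → contradiction y∈G y∉G)
  ... | y∈G with truth⁻ (G⊑ y y∈G)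
  ... | inj₁ y∈F = contradiction (λ _ → y∈F) y∉
  ... | inj₂ (d , refl) = subst (T ∘ G) (choose-cong F F d c (λ _ → id) (λ _ → id)) y∈G

  -- Families and collections of families are Boolean-valued, so `limit` may range over all
  -- collections of stages, even that of all stages, within `Set`. The empty family is the limit of
  -- no stages.
  data Stage : (A → Bool) → Set where
    step : ∀ {F} → Stage F → Stage (extend F)
    limit : ∀ S → (∀ F → T (S F) → Stage F) → Stage (⋃ S)

  private

    Below : (A → Bool) → (A → Bool) → Set
    Below F G = G ⊑ F ⊎ extend F ⊑ G

    below-limit : ∀ F S → (∀ G → T (S G) → Below F G) → Below F (⋃ S)
    below-limit F S below with decide (∃[ G ] (T (S G) × extend F ⊑ G))
    ... | yes (G , G∈S , p) = inj₂ (⊑-trans p (⊑-⋃ S G∈S))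
    ... | no none = inj₁ (⋃-⊑ S λ G G∈S → [ id , (λ p → contradiction (G , G∈S , p) none) ]′ (below G G∈S))

    -- In the last case F lies between G and `extend G` without being contained in G, so it contains
    -- all of `extend G`.
    above : ∀ {F H G} → F ⊑ H → ¬ F ⊑ G → Below F G → Below F (extend G) → extend G ⊑ H
    above F⊑H F⋢G (inj₂ p) _ = contradiction (⊑-trans (⊑-extend _) p) F⋢G
    above F⊑H F⋢G (inj₁ _) (inj₁ p) = ⊑-trans p F⊑H
    above F⊑H F⋢G (inj₁ G⊑F) (inj₂ p) =
      ⊑-trans (extend-cover G⊑F (⊑-trans (⊑-extend _) p) F⋢G) F⊑H

    -- The double induction of the Bourbaki-Witt theorem: a growing stage G stays inside F until it
    -- equals F, and its next step is then `extend F`.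
    comparable : ∀ {F G} → Stage F → Stage G → Below F G
    comparable F∈ (limit S S⊆) = below-limit _ S λ G G∈S → comparable F∈ (S⊆ G G∈S)
    comparable (step {F} F∈) (step {G} G∈) with comparable (step F∈) G∈
    ... | inj₂ p = inj₂ (⊑-trans p (⊑-extend G))
    ... | inj₁ G⊑F⁺ with decide (extend F ⊑ G) | decide (F ⊑ G)
    ... | yes F⁺⊑G | _ = inj₂ (extend-cong F⁺⊑G G⊑F⁺)
    ... | no F⁺⋢G | no F⋢G = inj₁ (above (⊑-extend F) F⋢G (comparable F∈ G∈) (comparable F∈ (step G∈)))
    ... | no F⁺⋢G | yes F⊑G with comparable F∈ G∈
    ... | inj₁ G⊑F = inj₁ (extend-cong G⊑F F⊑G)
    ... | inj₂ F⁺⊑G = contradiction F⁺⊑G F⁺⋢G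
    comparable (limit S S⊆) (step {G} G∈) with comparable (limit S S⊆) G∈
    ... | inj₂ p = inj₂ (⊑-trans p (⊑-extend G))
    ... | inj₁ G⊑S with decide (⋃ S ⊑ G)
    ... | yes S⊑G = inj₂ (extend-cong S⊑G G⊑S)
    ... | no S⋢G with decide (∃[ F ] (T (S F) × ¬ F ⊑ G))
    ... | no none = contradiction (⋃-⊑ S λ F F∈S → by-contradiction λ F⋢G → none (F , F∈S , F⋢G)) S⋢G
    ... | yes (F , F∈S , F⋢G) =
      inj₁ (above (⊑-⋃ S F∈S) F⋢G (comparable (S⊆ F F∈S) G∈) (comparable (S⊆ F F∈S) (step G∈)))

  stages-linear : ∀ {F G} → Stage F → Stage G → F ⊑ G ⊎ G ⊑ F
  stages-linear F∈ G∈ with comparable F∈ G∈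
  ... | inj₁ p = inj₂ p
  ... | inj₂ p = inj₁ (⊑-trans (⊑-extend _) p)

  top : A → Bool
  top = ⋃ (truth ∘ Stage)

  top-stage : Stage top
  top-stage = limit (truth ∘ Stage) λ F → truth⁻

  -- As the union of all stages `top` is itself a stage, hence so is `extend top`; the element that
  -- it would add already belongs to `top`.
  top-maximal : ∀ {x} → Addable top x → T (top x)
  top-maximal {x} ok = by-contradiction λ x∉ →
    choose-new top (x , ok , x∉)
      (⊑-⋃ (truth ∘ Stage) (truth⁺ (step top-stage)) _ (truth⁺ (inj₂ ((x , ok , x∉) , refl))))

-- Points of a Boolean algebra.

-- A representation of 𝔸 as a field of sets of points: ⊩-full lets inequalities be checked pointwise.
record Realization (𝔸 : BooleanAlgebra 0ℓ 0ℓ) (Point : Set) : Set₁ where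
  open BooleanAlgebra 𝔸 renaming (¬_ to −_)
  infix 4 _⊩_
  field
    _⊩_    : Point → Carrier → Set
    ⊩-resp : ∀ {p x y} → x ≈ y → p ⊩ x → p ⊩ y
    ⊩-∧    : ∀ {p x y} → p ⊩ x ∧ y ⇔ (p ⊩ x × p ⊩ y)
    ⊩-−    : ∀ {p x} → p ⊩ − x ⇔ (¬ p ⊩ x)
    ⊩-full : ∀ {x} → x ≉ ⊥ → ∃[ p ] p ⊩ x

-- Extending a centered family to an ultrafilter.

module UltrafilterExtension
  (em : ∀ ℓ → ExcludedMiddle ℓ) (ac : ∀ a ℓ → AxiomOfChoice a ℓ) (𝔸 : BooleanAlgebra 0ℓ 0ℓ)
  (C : Pred (BooleanAlgebra.Carrier 𝔸) 0ℓ) (C-centered : Centered 𝔸 C) where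

  open Classical em
  open BooleanAlgebra 𝔸 renaming (¬_ to −_; refl to ≈-refl; sym to ≈-sym; trans to ≈-trans)
  open BooleanAlgebraProperties 𝔸 using (∧-identityʳ; ∧-zeroʳ; ∨-identityʳ)
  open MeetSemilattice (LatticeProperties.∧-orderTheoreticMeetSemilattice lattice)
    using () renaming (_≤_ to _⊴_; trans to ⊴-trans; x∧y≤x to ∧-lowerˡ; x∧y≤y to ∧-lowerʳ; ∧-greatest to ∧-glb; refl to ⊴-refl)

  ⋀ : List Carrier → Carrier
  ⋀ = foldr _∧_ ⊤

  _∪C : (Carrier → Bool) → Pred Carrier 0ℓ
  (F ∪C) x = x ∈ C ⊎ T (F x)

  Addable : (Carrier → Bool) → Carrier → Set
  Addable F x = ∀ xs → All (F ∪C) xs → ⋀ xs ∧ x ≉ ⊥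

  ∪C-mono : ∀ {F G} → (∀ y → T (F y) → T (G y)) → ∀ {xs} → All (F ∪C) xs → All (G ∪C) xs
  ∪C-mono sub = All.map λ { (inj₁ c) → inj₁ c ; (inj₂ t) → inj₂ (sub _ t) }

  open Tower em ac Addable (λ sub ok xs all → ok xs (∪C-mono sub all))

  ⊴⊥⇒≈⊥ : ∀ {x y} → x ⊴ y → y ≈ ⊥ → x ≈ ⊥
  ⊴⊥⇒≈⊥ x⊴y y≈⊥ = ≈-trans x⊴y (≈-trans (∧-congˡ y≈⊥) (∧-zeroʳ _))

  -- The added element may occur several times in `xs`, but by idempotence a single copy accounts
  -- for all occurrences.
  split-extend : ∀ F (c : Candidate F) xs → All (extend F ∪C) xs →
    ∃[ ys ] (All (F ∪C) ys × ⋀ ys ∧ choose F c ⊴ ⋀ xs)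
  split-extend F c [] [] = [] , [] , ≈-sym (∧-identityʳ _)
  split-extend F c (x ∷ xs) (x∈ ∷ xs∈) with split-extend F c xs xs∈
  ... | ys , ys∈ , ys⊴ = insert x∈
    where
    old : (F ∪C) x → ∃[ ys ] (All (F ∪C) ys × ⋀ ys ∧ choose F c ⊴ x ∧ ⋀ xs)
    old x∈F = x ∷ ys , x∈F ∷ ys∈ ,
      ∧-glb (⊴-trans (∧-lowerˡ _ _) (∧-lowerˡ _ _))
            (⊴-trans (∧-glb (⊴-trans (∧-lowerˡ _ _) (∧-lowerʳ _ _)) (∧-lowerʳ _ _)) ys⊴)
    insert : (extend F ∪C) x → ∃[ ys ] (All (F ∪C) ys × ⋀ ys ∧ choose F c ⊴ x ∧ ⋀ xs)
    insert (inj₁ x∈C) = old (inj₁ x∈C)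
    insert (inj₂ x∈F⁺) with truth⁻ x∈F⁺
    ... | inj₁ x∈F = old (inj₂ x∈F)
    ... | inj₂ (d , refl) = ys , ys∈ ,
      ∧-glb (subst (λ z → ⋀ ys ∧ choose F c ⊴ z) (choose-cong F F c d (λ _ → id) (λ _ → id)) (∧-lowerʳ _ _)) ys⊴

  -- Stages form a chain, so finitely many members of their union lie in one of them. The first
  -- alternative is there because `S` may be empty.
  in-one-stage : ∀ S → (∀ F → T (S F) → Stage F) → ∀ xs → All (⋃ S ∪C) xs →
    All C xs ⊎ ∃[ F ] (T (S F) × All (F ∪C) xs)
  in-one-stage S S⊆ [] [] = inj₁ []
  in-one-stage S S⊆ (x ∷ xs) (x∈ ∷ xs∈) with x∈ | in-one-stage S S⊆ xs xs∈
  ... | inj₁ x∈C | inj₁ all = inj₁ (x∈C ∷ all)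
  ... | inj₁ x∈C | inj₂ (F , F∈S , all) = inj₂ (F , F∈S , inj₁ x∈C ∷ all)
  ... | inj₂ x∈⋃ | rest with truth⁻ x∈⋃ | rest
  ... | G , G∈S , x∈G | inj₁ all = inj₂ (G , G∈S , inj₂ x∈G ∷ All.map inj₁ all)
  ... | G , G∈S , x∈G | inj₂ (F , F∈S , all) with stages-linear (S⊆ F F∈S) (S⊆ G G∈S)
  ... | inj₁ F⊑G = inj₂ (G , G∈S , inj₂ x∈G ∷ ∪C-mono F⊑G all)
  ... | inj₂ G⊑F = inj₂ (F , F∈S , inj₂ (G⊑F x x∈G) ∷ all)

  stage-centered : ∀ {F} → Stage F → Centered 𝔸 (F ∪C)
  stage-centered (step {F} F∈) xs all ⋀≈⊥ with decide (Candidate F)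
  ... | yes c with split-extend F c xs all
  ...   | ys , ys∈ , ys⊴ = choose-addable F c ys ys∈ (⊴⊥⇒≈⊥ ys⊴ ⋀≈⊥)
  stage-centered (step {F} F∈) xs all ⋀≈⊥ | no ¬c = stage-centered F∈ xs (All.map old all) ⋀≈⊥
    where
    old : ∀ {x} → (extend F ∪C) x → (F ∪C) x
    old (inj₁ x∈C) = inj₁ x∈C
    old (inj₂ x∈F⁺) with truth⁻ x∈F⁺
    ... | inj₁ x∈F = inj₂ x∈F
    ... | inj₂ (c , _) = contradiction c ¬c
  stage-centered (limit S S⊆) xs all with in-one-stage S S⊆ xs all
  ... | inj₁ all-C = C-centered xs all-C
  ... | inj₂ (F , F∈S , all-F) = stage-centered (S⊆ F F∈S) xs all-F

  infix 4 _∈𝕌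

  _∈𝕌 : Carrier → Set
  x ∈𝕌 = T (top x)

  𝕌-centered : ∀ xs → All _∈𝕌 xs → ⋀ xs ≉ ⊥
  𝕌-centered xs = stage-centered top-stage xs ∘ All.map inj₂

  C⊆𝕌 : ∀ {x} → x ∈ C → x ∈𝕌
  C⊆𝕌 {x} x∈C = top-maximal λ xs all meet≈⊥ →
    stage-centered top-stage (x ∷ xs) (inj₁ x∈C ∷ all) (≈-trans (∧-comm _ _) meet≈⊥)

  ⋀-++ : ∀ xs ys → ⋀ (xs ++ ys) ⊴ ⋀ xs ∧ ⋀ ys
  ⋀-++ [] ys = ∧-glb (≈-sym (∧-identityʳ _)) ⊴-refl
  ⋀-++ (x ∷ xs) ys = ∧-glb
    (∧-glb (∧-lowerˡ _ _) (⊴-trans (∧-lowerʳ _ _) (⊴-trans (⋀-++ xs ys) (∧-lowerˡ _ _))))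
    (⊴-trans (∧-lowerʳ _ _) (⊴-trans (⋀-++ xs ys) (∧-lowerʳ _ _)))

  -- If neither `x` nor `− x` could be added, two finite subfamilies would have meets disjoint from
  -- `x` and from `− x`; together they would have meet `⊥`.
  𝕌-ultra : ∀ x → ¬ x ∈𝕌 → − x ∈𝕌
  𝕌-ultra x x∉ = by-contradiction λ −x∉ →
    refute (¬∀⇒∃¬ (x∉ ∘ top-maximal)) (¬∀⇒∃¬ (−x∉ ∘ top-maximal))
    where
    below : ∀ {y z} → y ⊴ z → ⋀ (y ∷ []) ⊴ z
    below = ⊴-trans (∧-lowerˡ _ _)
    refute : ∃[ xs ] ¬ (All (top ∪C) xs → ⋀ xs ∧ x ≉ ⊥) →
             ¬ (∃[ ys ] ¬ (All (top ∪C) ys → ⋀ ys ∧ − x ≉ ⊥))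
    refute (xs , p) (ys , q) = p λ xs∈ xs≈⊥ → q λ ys∈ ys≈⊥ →
      stage-centered top-stage (xs ++ ys) (++⁺ xs∈ ys∈)
        (≈-trans (≈-sym (∧-identityʳ _)) (≈-trans (∧-congˡ (≈-sym (∨-complementʳ x)))
          (≈-trans (∧-distribˡ-∨ _ _ _) (≈-trans
            (∨-cong (⊴⊥⇒≈⊥ (∧-glb (⊴-trans (∧-lowerˡ _ _) (⊴-trans (⋀-++ xs ys) (∧-lowerˡ _ _))) (∧-lowerʳ _ _)) xs≈⊥)
                    (⊴⊥⇒≈⊥ (∧-glb (⊴-trans (∧-lowerˡ _ _) (⊴-trans (⋀-++ xs ys) (∧-lowerʳ _ _))) (∧-lowerʳ _ _)) ys≈⊥))
            (∨-identityʳ _)))))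

  𝕌-closed : ∀ {y} xs → All _∈𝕌 xs → ⋀ xs ⊴ y → y ∈𝕌
  𝕌-closed {y} xs all xs⊴y = by-contradiction λ y∉ →
    𝕌-centered (− y ∷ xs) (𝕌-ultra y y∉ ∷ all)
      (⊴⊥⇒≈⊥ (∧-glb (∧-lowerˡ _ _) (⊴-trans (∧-lowerʳ _ _) xs⊴y)) (∧-complementˡ y))

module _ (em : ∀ ℓ → ExcludedMiddle ℓ) (ac : ∀ a ℓ → AxiomOfChoice a ℓ) {𝔸 : BooleanAlgebra 0ℓ 0ℓ} where

  open BooleanAlgebra 𝔸 renaming (¬_ to −_; refl to ≈-refl; sym to ≈-sym; trans to ≈-trans)
  open MeetSemilattice (LatticeProperties.∧-orderTheoreticMeetSemilattice lattice)
    using () renaming (_≤_ to _⊴_; trans to ⊴-trans; x∧y≤x to ∧-lowerˡ; x∧y≤y to ∧-lowerʳ; ∧-greatest to ∧-glb; reflexive to ⊴-reflexive)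

  -- Countably many points suffice: a nonzero element lies in some `C m`, hence in the ultrafilter
  -- extending it.
  ultrafilterRealization : σ-Centered 𝔸 → Realization 𝔸 ℕ
  ultrafilterRealization (C , centered , cover) = record
    { _⊩_ = λ m x → Ultra._∈𝕌 m x
    ; ⊩-resp = λ {m} {x} x≈y x∈ → Ultra.𝕌-closed m (x ∷ []) (x∈ ∷ []) (⊴-trans (∧-lowerˡ _ _) (⊴-reflexive x≈y))
    ; ⊩-∧ = λ {m} {x} {y} → mk⇔
        (λ xy∈ → Ultra.𝕌-closed m (x ∧ y ∷ []) (xy∈ ∷ []) (⊴-trans (∧-lowerˡ _ _) (∧-lowerˡ _ _))
               , Ultra.𝕌-closed m (x ∧ y ∷ []) (xy∈ ∷ []) (⊴-trans (∧-lowerˡ _ _) (∧-lowerʳ _ _)))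
        (λ (x∈ , y∈) → Ultra.𝕌-closed m (x ∷ y ∷ []) (x∈ ∷ y∈ ∷ [])
                         (∧-glb (∧-lowerˡ _ _) (⊴-trans (∧-lowerʳ _ _) (∧-lowerˡ _ _))))
    ; ⊩-− = λ {m} {x} → mk⇔
        (λ −x∈ x∈ → Ultra.𝕌-centered m (x ∷ − x ∷ []) (x∈ ∷ −x∈ ∷ [])
          (≈-trans (≈-sym (∧-assoc _ _ _)) (≈-trans (∧-congʳ (∧-complementʳ x))
            (BooleanAlgebraProperties.∧-zeroˡ 𝔸 _))))
        (Ultra.𝕌-ultra m x)
    ; ⊩-full = λ {x} x≉⊥ → let (m , x∈C) = Equivalence.to (cover x) x≉⊥ in m , Ultra.C⊆𝕌 m x∈C
    }
    where
    module Ultra (m : ℕ) = UltrafilterExtension em ac 𝔸 (C m) (centered m)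

-- Pointwise calculus, cylinders, and traces of names for reals.

module RealizationProperties (em : ∀ ℓ → ExcludedMiddle ℓ) {𝔸 : BooleanAlgebra 0ℓ 0ℓ} {Point : Set} (ρ : Realization 𝔸 Point) where

  open Classical em
  open Realization ρ
  open BooleanAlgebra 𝔸 renaming (¬_ to −_; refl to ≈-refl; sym to ≈-sym; trans to ≈-trans)
  open BooleanAlgebraProperties 𝔸 using (∧-identityʳ; ∨-identityʳ; deMorgan₂)
  open Poset (LatticeProperties.poset lattice) using () renaming (_≤_ to _⊴_)

  ⊩-resp⁻ : ∀ {p x y} → x ≈ y → p ⊩ y → p ⊩ x
  ⊩-resp⁻ x≈y = ⊩-resp (≈-sym x≈y)

  ∧⁻ : ∀ {p x y} → p ⊩ x ∧ y → p ⊩ x × p ⊩ y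
  ∧⁻ = Equivalence.to ⊩-∧

  ∧⁺ : ∀ {p x y} → p ⊩ x → p ⊩ y → p ⊩ x ∧ y
  ∧⁺ p⊩x p⊩y = Equivalence.from ⊩-∧ (p⊩x , p⊩y)

  −⁻ : ∀ {p x} → p ⊩ − x → ¬ p ⊩ x
  −⁻ = Equivalence.to ⊩-−

  −⁺ : ∀ {p x} → ¬ p ⊩ x → p ⊩ − x
  −⁺ = Equivalence.from ⊩-−

  ⊮⊥ : ∀ {p} → ¬ p ⊩ ⊥
  ⊮⊥ p⊩⊥ = let (p⊩x , p⊩−x) = ∧⁻ (⊩-resp⁻ (∧-complementʳ ⊥) p⊩⊥) in −⁻ p⊩−x p⊩x

  ⊩⊤ : ∀ {p} → p ⊩ ⊤
  ⊩⊤ = by-contradiction λ p⊮⊤ → ⊮⊥ (⊩-resp (∧-complementʳ ⊤) (⊩-resp⁻ (∧-comm _ _) (⊩-resp⁻ (∧-identityʳ _) (−⁺ p⊮⊤))))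

  ∨⁻ : ∀ {p x y} → p ⊩ x ∨ y → p ⊩ x ⊎ p ⊩ y
  ∨⁻ {p} {x} {y} p⊩ with decide (p ⊩ x) | decide (p ⊩ y)
  ... | yes p⊩x | _ = inj₁ p⊩x
  ... | no _ | yes p⊩y = inj₂ p⊩y
  ... | no p⊮x | no p⊮y = contradiction p⊩ (−⁻ (⊩-resp⁻ (deMorgan₂ x y) (∧⁺ (−⁺ p⊮x) (−⁺ p⊮y))))

  ⊩-mono : ∀ {p x y} → x ⊴ y → p ⊩ x → p ⊩ y
  ⊩-mono x⊴y p⊩x = proj₂ (∧⁻ (⊩-resp x⊴y p⊩x))

  ∨⁺ˡ : ∀ {p x y} → p ⊩ x → p ⊩ x ∨ y
  ∨⁺ˡ {x = x} {y} = ⊩-mono (≈-sym (∧-absorbs-∨ x y))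

  ∨⁺ʳ : ∀ {p x y} → p ⊩ y → p ⊩ x ∨ y
  ∨⁺ʳ p⊩y = ⊩-resp (∨-comm _ _) (∨⁺ˡ p⊩y)

  ⊩⇒≉⊥ : ∀ {p x} → p ⊩ x → x ≉ ⊥
  ⊩⇒≉⊥ p⊩x x≈⊥ = ⊮⊥ (⊩-resp x≈⊥ p⊩x)

  ⊮⇒≈⊥ : ∀ {x} → (∀ p → ¬ p ⊩ x) → x ≈ ⊥
  ⊮⇒≈⊥ empty = by-contradiction λ x≉⊥ → let (p , p⊩x) = ⊩-full x≉⊥ in empty p p⊩x

  ⊩⇒⊴ : ∀ {x y} → (∀ p → p ⊩ x → p ⊩ y) → x ⊴ y
  ⊩⇒⊴ {x} {y} sub = begin
    x                       ≈⟨ ∧-identityʳ x ⟨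
    x ∧ ⊤                   ≈⟨ ∧-congˡ (∨-complementʳ y) ⟨
    x ∧ (y ∨ − y)           ≈⟨ ∧-distribˡ-∨ x y (− y) ⟩
    (x ∧ y) ∨ (x ∧ − y)     ≈⟨ ∨-congˡ (⊮⇒≈⊥ λ p p⊩ → −⁻ (proj₂ (∧⁻ p⊩)) (sub p (proj₁ (∧⁻ p⊩)))) ⟩
    (x ∧ y) ∨ ⊥             ≈⟨ ∨-identityʳ (x ∧ y) ⟩
    x ∧ y                   ∎
    where open import Relation.Binary.Reasoning.Setoid setoid

  ⊩⇒≈ : ∀ {x y} → (∀ p → p ⊩ x → p ⊩ y) → (∀ p → p ⊩ y → p ⊩ x) → x ≈ y
  ⊩⇒≈ p q = Poset.antisym (LatticeProperties.poset lattice) (⊩⇒⊴ p) (⊩⇒⊴ q)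

  -- A nonzero member of B that no member of B splits would be an atom of B.
  atomless-split : ∀ {B a p} → IsSubalgebra 𝔸 B → Atomless 𝔸 B → a ∈ B → p ⊩ a →
    ∃[ b ] (b ∈ B × (∃[ q ] (q ⊩ a × q ⊩ b)) × (∃[ q ] (q ⊩ a × ¬ q ⊩ b)))
  atomless-split {B} {a} {p} sub atomless a∈B p⊩a = by-contradiction λ none →
    atomless a (record
      { member = a∈B
      ; nonzero = ⊩⇒≉⊥ p⊩a
      ; minimal = λ {b} b∈B b⊴a → minimal none b∈B b⊴a
      })
    where
    minimal : ¬ (∃[ b ] (b ∈ B × (∃[ q ] (q ⊩ a × q ⊩ b)) × (∃[ q ] (q ⊩ a × ¬ q ⊩ b)))) →
      ∀ {b} → b ∈ B → b ⊴ a → b ≈ ⊥ ⊎ b ≈ a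
    minimal none {b} b∈B b⊴a with decide (b ≈ ⊥)
    ... | yes b≈⊥ = inj₁ b≈⊥
    ... | no b≉⊥ = inj₂ (⊩⇒≈ (λ q → ⊩-mono b⊴a) λ q q⊩a → by-contradiction λ q⊮b →
            let (q′ , q′⊩b) = ⊩-full b≉⊥
            in none (b , b∈B , (q′ , ⊩-mono b⊴a q′⊩b , q′⊩b) , (q , q⊩a , q⊮b)))

  ⊤-sup : ∀ {B X} → ⊤ ∈ B → (∀ {c} → c ∈ B → (∀ {x} → x ∈ X → x ⊴ c) → ∀ p → p ⊩ c) → IsSup 𝔸 B X ⊤
  ⊤-sup ⊤∈B least = record
    { member = ⊤∈B
    ; upper = λ _ → ⊩⇒⊴ λ _ _ → ⊩⊤
    ; least = λ c∈B bound → ⊩⇒⊴ λ p _ → least c∈B bound p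
    }

  signed : Bool → Carrier → Carrier
  signed true x = x
  signed false x = − x

  ⊩-signed : ∀ v {p x} → p ⊩ signed v x ⇔ truth (p ⊩ x) ≡ v
  ⊩-signed true = mk⇔ truth-true true-truth
  ⊩-signed false = mk⇔ (λ p⊩ → truth-false (−⁻ p⊩)) (λ eq → −⁺ (false-truth eq))

  -- `y s` decides the bit that follows `s`. If it depends only on the length of `s`, these are the
  -- cylinders of a name for a real; in general they are the nodes of a binary tree.
  cyl : (List Bool → Carrier) → List Bool → Carrier
  cyl y [] = ⊤
  cyl y (v ∷ s) = signed v (y s) ∧ cyl y s

  module _ (y : List Bool → Carrier) (h : Point → Cantor)
    (tracks : ∀ {p} s → Through (h p) s → h p (length s) ≡ truth (p ⊩ y s)) where

    cyl⇒Through : ∀ {p} s → p ⊩ cyl y s → Through (h p) s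
    cyl⇒Through [] _ = refl
    cyl⇒Through (v ∷ s) p⊩ with ∧⁻ p⊩
    ... | p⊩v , p⊩s = cong₂ _∷_ (trans (tracks s (cyl⇒Through s p⊩s)) (Equivalence.to (⊩-signed v) p⊩v))
                               (cyl⇒Through s p⊩s)

    Through⇒cyl : ∀ {p} s → Through (h p) s → p ⊩ cyl y s
    Through⇒cyl [] _ = ⊩⊤
    Through⇒cyl (v ∷ s) p∋ =
      ∧⁺ (Equivalence.from (⊩-signed v) (trans (sym (tracks s (∷-injectiveʳ p∋))) (∷-injectiveˡ p∋)))
         (Through⇒cyl s (∷-injectiveʳ p∋))

  -- The evaluation at the point p of the name for a real whose i-th bit has Boolean value `r i`.
  real : (ℕ → Carrier) → Point → Cantor
  real r p i = truth (p ⊩ r i)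

  cylinder : (ℕ → Carrier) → List Bool → Carrier
  cylinder r = cyl (r ∘ length)

  cylinder⇒Through : ∀ {r p} s → p ⊩ cylinder r s → Through (real r p) s
  cylinder⇒Through {r} = cyl⇒Through (r ∘ length) (real r) λ s _ → refl

  Through⇒cylinder : ∀ {r p} s → Through (real r p) s → p ⊩ cylinder r s
  Through⇒cylinder {r} = Through⇒cyl (r ∘ length) (real r) λ s _ → refl

  trace : (ℕ → Carrier) → Carrier → Pred Cantor 0ℓ
  trace r a y = ∃[ p ] (p ⊩ a × real r p ≡ y)

  -- Genericity: no nonzero element confines the real to a nowhere dense set.
  Cohen : (ℕ → Carrier) → Set
  Cohen r = ∀ {a p} → p ⊩ a → SomewhereDense (trace r a)

-- The countable regular subalgebra generated by a Cohen real.

strings : ℕ → List (List Bool)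
strings zero = [] ∷ []
strings (suc n) = map (true ∷_) (strings n) ++ map (false ∷_) (strings n)

restrict∈strings : ∀ x n → restrict x n ∈ˡ strings n
restrict∈strings x zero = here refl
restrict∈strings x (suc n) with x n
... | true = ∈-++⁺ˡ (∈-map⁺ (true ∷_) (restrict∈strings x n))
... | false = ∈-++⁺ʳ (map (true ∷_) (strings n)) (∈-map⁺ (false ∷_) (restrict∈strings x n))

module CohenSubalgebra (em : ∀ ℓ → ExcludedMiddle ℓ) {𝔸 : BooleanAlgebra 0ℓ 0ℓ} {Point : Set} (ρ : Realization 𝔸 Point)
  (r : ℕ → BooleanAlgebra.Carrier 𝔸) where

  open Classical em
  open Realization ρ
  open RealizationProperties em ρ
  open BooleanAlgebra 𝔸 renaming (¬_ to −_; refl to ≈-refl; sym to ≈-sym; trans to ≈-trans)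
  open Poset (LatticeProperties.poset lattice) using () renaming (_≤_ to _⊴_)

  -- The subalgebra generated by the `r i`, described through dependence on finitely many bits so
  -- that closure under the operations is immediate.
  Finitary : Pred Carrier 0ℓ
  Finitary x = ∃[ n ] (∀ p q → real r q ∈ Nbhd (real r p) n → p ⊩ x → q ⊩ x)

  r-finitary : ∀ i → r i ∈ Finitary
  r-finitary i = suc i , λ p q agree p⊩ → true-truth (trans (sym (agree i ≤-refl)) (truth-true p⊩))

  isSubalgebra : IsSubalgebra 𝔸 Finitary
  isSubalgebra = record
    { resp = λ x≈y (n , dec) → n , λ p q agree p⊩y → ⊩-resp x≈y (dec p q agree (⊩-resp⁻ x≈y p⊩y))
    ; ⊤-closed = 0 , λ _ _ _ _ → ⊩⊤
    ; ⊥-closed = 0 , λ _ _ _ p⊩⊥ → contradiction p⊩⊥ ⊮⊥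
    ; ∨-closed = λ (m , dec) (n , dec′) → m + n , λ p q agree p⊩ →
        [ ∨⁺ˡ ∘ dec p q (Nbhd-≤ (m≤m+n m n) agree) , ∨⁺ʳ ∘ dec′ p q (Nbhd-≤ (m≤n+m n m) agree) ]′ (∨⁻ p⊩)
    ; ∧-closed = λ (m , dec) (n , dec′) → m + n , λ p q agree p⊩ → let (p⊩x , p⊩y) = ∧⁻ p⊩ in
        ∧⁺ (dec p q (Nbhd-≤ (m≤m+n m n) agree) p⊩x) (dec′ p q (Nbhd-≤ (m≤n+m n m) agree) p⊩y)
    ; −-closed = λ (n , dec) → n , λ p q agree p⊩ →
        −⁺ λ q⊩ → −⁻ p⊩ (dec q p (λ i i<n → sym (agree i i<n)) q⊩)
    }

  open IsSubalgebra isSubalgebra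

  signed-finitary : ∀ v {x} → x ∈ Finitary → signed v x ∈ Finitary
  signed-finitary true = id
  signed-finitary false = −-closed

  cylinder-finitary : ∀ s → cylinder r s ∈ Finitary
  cylinder-finitary [] = ⊤-closed
  cylinder-finitary (v ∷ s) = ∧-closed (signed-finitary v (r-finitary (length s))) (cylinder-finitary s)

  ⋁cyl : List (List Bool) → Carrier
  ⋁cyl = foldr (λ s x → cylinder r s ∨ x) ⊥

  ⋁cyl-finitary : ∀ L → ⋁cyl L ∈ Finitary
  ⋁cyl-finitary [] = ⊥-closed
  ⋁cyl-finitary (s ∷ L) = ∨-closed (cylinder-finitary s) (⋁cyl-finitary L)

  ⋁cyl⁻ : ∀ {p} L → p ⊩ ⋁cyl L → ∃[ s ] (s ∈ˡ L × Through (real r p) s)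
  ⋁cyl⁻ [] p⊩ = contradiction p⊩ ⊮⊥
  ⋁cyl⁻ (s ∷ L) p⊩ with ∨⁻ p⊩
  ... | inj₁ p⊩s = s , here refl , cylinder⇒Through s p⊩s
  ... | inj₂ p⊩L with ⋁cyl⁻ L p⊩L
  ... | t , t∈L , p∋t = t , there t∈L , p∋t

  ⋁cyl⁺ : ∀ {p s} L → s ∈ˡ L → Through (real r p) s → p ⊩ ⋁cyl L
  ⋁cyl⁺ {s = s} (_ ∷ L) (here refl) p∋ = ∨⁺ˡ (Through⇒cylinder s p∋)
  ⋁cyl⁺ (_ ∷ L) (there s∈L) p∋ = ∨⁺ʳ (⋁cyl⁺ L s∈L p∋)

  -- An element decided by `n` bits contains every cylinder of length `n` that it meets, so it is
  -- the join of those.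
  finitary⇒⋁cyl : ∀ {x} → x ∈ Finitary → ∃[ L ] ⋁cyl L ≈ x
  finitary⇒⋁cyl {x} (n , dec) = L , ⊩⇒≈ to from
    where
    Meets : Pred (List Bool) 0ℓ
    Meets s = ∃[ p ] (p ⊩ x × restrict (real r p) n ≡ s)
    L : List (List Bool)
    L = filter (λ s → decide (Meets s)) (strings n)
    to : ∀ q → q ⊩ ⋁cyl L → q ⊩ x
    to q q⊩ with ⋁cyl⁻ L q⊩
    ... | s , s∈L , q∋s with ∈-filter⁻ (λ s → decide (Meets s)) {xs = strings n} s∈L
    ... | _ , p , p⊩x , refl = dec p q
      (restrict⇒Nbhd n (trans (sym q∋s) (cong (restrict (real r q)) (length-restrict (real r p) n)))) p⊩x
    from : ∀ q → q ⊩ x → q ⊩ ⋁cyl L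
    from q q⊩x = ⋁cyl⁺ L
      (∈-filter⁺ (λ s → decide (Meets s)) (restrict∈strings (real r q) n) (q , q⊩x , refl))
      (restrict-Through (real r q) n)

  countable : Countable 𝔸 Finitary
  countable = ⋁cyl ∘ to , ⋁cyl-finitary ∘ to , λ b∈ →
    let (L , eq) = finitary⇒⋁cyl b∈ in to⁻ L , ≈-trans (≡⇒≈ (cong ⋁cyl (to∘to⁻ L))) eq
    where
    open Surjection (↠List (↠List ℕ↠Bool)) using (to; to⁻; to∘to⁻)
    ≡⇒≈ : ∀ {x y} → x ≡ y → x ≈ y
    ≡⇒≈ refl = ≈-refl

  module _ (cohen : Cohen r) where

    atomless : Atomless 𝔸 Finitary
    atomless a atom with ⊩-full (IsAtom.nonzero atom)
    ... | p , p⊩a with cohen p⊩a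
    -- Both one-bit extensions of `s` occur inside the atom, so `r (length s)` splits it.
    ... | s , dense with dense (true ∷ []) | dense (false ∷ [])
    ... | _ , (p₁ , p₁⊩a , refl) , p₁∋ | _ , (p₀ , p₀⊩a , refl) , p₀∋
        with IsAtom.minimal atom {a ∧ r (length s)} (∧-closed (IsAtom.member atom) (r-finitary (length s)))
               (⊩⇒⊴ λ q → proj₁ ∘ ∧⁻)
    ... | inj₁ ≈⊥ = ⊩⇒≉⊥ (∧⁺ p₁⊩a (true-truth (∷-injectiveˡ p₁∋))) ≈⊥
    ... | inj₂ ≈a = false-truth (∷-injectiveˡ p₀∋) (proj₂ (∧⁻ (⊩-resp⁻ ≈a p₀⊩a)))

    -- If an upper bound `c` is not `⊤`, the trace of `− c` is dense below some `s`. Some member of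
    -- X meets the cylinder of `s`, as otherwise the complement of that nonzero cylinder would bound
    -- X inside the subalgebra. This member contains a smaller cylinder, which `− c` meets.
    regular : Regular 𝔸 Finitary
    regular X X⊆ sup = ⊤-sup _ λ {c} _ bound p → by-contradiction λ p⊮c → dense-outside bound (cohen (−⁺ p⊮c))
      where
      dense-outside : ∀ {c} → (∀ {x} → x ∈ X → x ⊴ c) → ¬ SomewhereDense (trace r (− c))
      dense-outside {c} bound (s , dense) with decide (∃[ x ] (x ∈ X × ∃[ q ] (q ⊩ x × q ⊩ cylinder r s)))
      ... | no none with dense []
      ... | _ , (q , q⊩ , refl) , q∋s = −⁻
        (⊩-mono (IsSup.least sup (−-closed (cylinder-finitary s))
                  λ x∈X → ⊩⇒⊴ λ q q⊩x → −⁺ λ q⊩s → none (_ , x∈X , q , q⊩x , q⊩s)) (⊩⊤ {q}))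
        (Through⇒cylinder s q∋s)
      dense-outside {c} bound (s , dense) | yes (x , x∈X , q , q⊩x , q⊩s)
        with X⊆ x∈X
      -- A string of `n + length s` bits both extends `s` and decides `x`.
      ... | n , dec with Through-extend n s (cylinder⇒Through s q⊩s)
      ... | w , eq with dense w
      ... | _ , (q′ , q′⊩−c , refl) , q′∋ =
        −⁻ q′⊩−c (⊩-mono (bound x∈X) (dec q q′ (Nbhd-≤ (m≤m+n n (length s)) (restrict⇒Nbhd (n + length s) agree)) q⊩x))
        where
        agree : restrict (real r q) (n + length s) ≡ restrict (real r q′) (n + length s)
        agree = trans eq (trans (sym q′∋) (cong (restrict (real r q′))
          (trans (cong length (sym eq)) (length-restrict (real r q) _))))

    hasCountableRegularSubalgebra : HasCountableRegularSubalgebra 𝔸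
    hasCountableRegularSubalgebra = Finitary , isSubalgebra , atomless , countable , regular

-- Suprema and disjoint refinements.

module Sups (em : ∀ ℓ → ExcludedMiddle ℓ) {𝔸 : BooleanAlgebra 0ℓ 0ℓ} {Point : Set} (ρ : Realization 𝔸 Point)
  (complete : Complete 𝔸) where

  open Classical em
  open Realization ρ
  open RealizationProperties em ρ
  open BooleanAlgebra 𝔸 using (Carrier; _∨_; _∧_; ⊥) renaming (¬_ to −_)

  ⋁ : Pred Carrier 0ℓ → Carrier
  ⋁ X = proj₁ (complete X)

  ⋁⁺ : ∀ {X x p} → x ∈ X → p ⊩ x → p ⊩ ⋁ X
  ⋁⁺ {X} x∈X = ⊩-mono (IsSup.upper (proj₂ (complete X)) x∈X)

  -- A point of a supremum need not lie in any member, but inequalities between elements still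
  -- pass from the members to the supremum.
  ⋁⁻ : ∀ {X} c d → (∀ {x q} → x ∈ X → q ⊩ x → q ⊩ c → q ⊩ d) → ∀ {p} → p ⊩ ⋁ X → p ⊩ c → p ⊩ d
  ⋁⁻ {X} c d sub p⊩X p⊩c = [ (λ p⊩−c → contradiction p⊩c (−⁻ p⊩−c)) , id ]′ (∨⁻
    (⊩-mono (IsSup.least (proj₂ (complete X)) {(− c) ∨ d} _
      λ x∈X → ⊩⇒⊴ λ q q⊩x → by-contradiction λ q⊮ →
        q⊮ (∨⁺ʳ (sub x∈X q⊩x (by-contradiction λ q⊮c → q⊮ (∨⁺ˡ (−⁺ q⊮c)))))) p⊩X))

  module Disjointify (x : ℕ → Carrier) where

    joins : ℕ → Carrier
    joins zero = ⊥
    joins (suc n) = joins n ∨ x n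

    δ : ℕ → Carrier
    δ n = x n ∧ − joins n

    δ⇒x : ∀ {p} n → p ⊩ δ n → p ⊩ x n
    δ⇒x n = proj₁ ∘ ∧⁻

    x⇒joins : ∀ {p m} n → m < n → p ⊩ x m → p ⊩ joins n
    x⇒joins (suc n) (s≤s m≤n) p⊩x with m≤n⇒m<n∨m≡n m≤n
    ... | inj₁ m<n = ∨⁺ˡ (x⇒joins n m<n p⊩x)
    ... | inj₂ refl = ∨⁺ʳ p⊩x

    joins⇒δ : ∀ {p} n → p ⊩ joins n → ∃[ k ] p ⊩ δ k
    joins⇒δ zero p⊩ = contradiction p⊩ ⊮⊥
    joins⇒δ {p} (suc n) p⊩ with decide (p ⊩ joins n)
    ... | yes p⊩n = joins⇒δ n p⊩n
    ... | no p⊮n = n , ∧⁺ ([ (λ p⊩n → contradiction p⊩n p⊮n) , id ]′ (∨⁻ p⊩)) (−⁺ p⊮n)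

    x⇒δ : ∀ {p} n → p ⊩ x n → ∃[ k ] p ⊩ δ k
    x⇒δ n = joins⇒δ (suc n) ∘ ∨⁺ʳ

    δ-≮ : ∀ {p m n} → p ⊩ δ m → p ⊩ δ n → ¬ m < n
    δ-≮ {m = m} {n} p⊩m p⊩n m<n = −⁻ (proj₂ (∧⁻ p⊩n)) (x⇒joins n m<n (δ⇒x m p⊩m))

    δ-unique : ∀ {p m n} → p ⊩ δ m → p ⊩ δ n → m ≡ n
    δ-unique p⊩m p⊩n = ≤-antisym (≮⇒≥ (δ-≮ p⊩n p⊩m)) (≮⇒≥ (δ-≮ p⊩m p⊩n))

-- A name that is somewhere dense at one ultrafilter.

module LocalReal (em : ∀ ℓ → ExcludedMiddle ℓ) {𝔸 : BooleanAlgebra 0ℓ 0ℓ} (ρ : Realization 𝔸 ℕ)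
  (complete : Complete 𝔸) (atomless : Atomless 𝔸 U) (n : ℕ) where

  open Classical em
  open Realization ρ
  open RealizationProperties em ρ
  open Sups em ρ complete
  open BooleanAlgebra 𝔸 using (Carrier; ⊤; ⊥) renaming (¬_ to −_)

  private

    -- Chooses for each ultrafilter m different from n an element of m outside n; for m equal to n
    -- the default `⊥` is outside n as well.
    separator : ∀ m → ∃[ x ] (¬ n ⊩ x × ((∃[ a ] (m ⊩ a × ¬ n ⊩ a)) → m ⊩ x))
    separator m with decide (∃[ a ] (m ⊩ a × ¬ n ⊩ a))
    ... | yes (a , m⊩a , n⊮a) = a , n⊮a , λ _ → m⊩a
    ... | no none = ⊥ , ⊮⊥ , λ a → contradiction a none

    open Disjointify (proj₁ ∘ separator)

    n⊮δ : ∀ k → ¬ n ⊩ δ k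
    n⊮δ k = proj₁ (proj₂ (separator k)) ∘ δ⇒x k

    -- Atomlessness splits `a` by some `b`. Whichever of `b` and `− b` is outside n has a point in
    -- common with `a`; that ultrafilter differs from n and therefore contains a cell.
    meets-δ : ∀ {p a} → p ⊩ a → ∃[ q ] (q ⊩ a × ∃[ k ] q ⊩ δ k)
    meets-δ {a = a} p⊩a with atomless-split U-sub atomless _ p⊩a
      where
      U-sub : IsSubalgebra 𝔸 U
      U-sub = _
    ... | b , _ , (q , q⊩a , q⊩b) , (q′ , q′⊩a , q′⊮b) with decide (n ⊩ b)
    ... | yes n⊩b = q′ , q′⊩a , x⇒δ q′ (proj₂ (proj₂ (separator q′)) (− b , −⁺ q′⊮b , λ n⊩−b → −⁻ n⊩−b n⊩b))
    ... | no n⊮b = q , q⊩a , x⇒δ q (proj₂ (proj₂ (separator q)) (b , q⊩b , n⊮b))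

    piece : Pred ℕ 0ℓ → Pred Carrier 0ℓ
    piece A x = ∃[ k ] (k ∈ A × x ≡ δ k)

    piece-cover : ∀ {p} → p ⊩ ⋁ (piece U)
    piece-cover = by-contradiction λ p⊮ → let (q , q⊩− , k , q⊩δ) = meets-δ (−⁺ p⊮) in
      −⁻ q⊩− (⋁⁺ (k , _ , refl) q⊩δ)

    D : Pred (Pred ℕ 0ℓ) 0ℓ
    D A = n ⊩ ⋁ (piece A)

    isUltrafilter : IsUltrafilter D
    isUltrafilter = record
      { U∈D = piece-cover
      ; ∅∉D = λ n⊩ → ⊮⊥ (⋁⁻ ⊤ ⊥ (λ { (_ , () , _) }) n⊩ ⊩⊤)
      ; upward = λ {A} {B} A⊆B n⊩ → ⋁⁻ ⊤ (⋁ (piece B))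
          (λ { (k , k∈A , refl) q⊩ _ → ⋁⁺ (k , A⊆B k∈A , refl) q⊩ }) n⊩ ⊩⊤
      ; ∩-closed = λ {A} {B} → ⋁⁻ (⋁ (piece B)) (⋁ (piece (A ∩ B)))
          λ { (j , j∈A , refl) q⊩j q⊩B → ⋁⁻ (δ j) (⋁ (piece (A ∩ B)))
            (λ { (k , k∈B , refl) q⊩k q⊩j → ⋁⁺ (k , (subst A (δ-unique q⊩j q⊩k) j∈A , k∈B) , refl) q⊩k })
            q⊩B q⊩j }
      ; ultra = ultra
      }
      where
      ultra : ∀ A → A ∈ D ⊎ ∁ A ∈ D
      ultra A with decide (n ⊩ ⋁ (piece A))
      ... | yes A∈D = inj₁ A∈D
      ... | no A∉D = inj₂ (⋁⁻ (− ⋁ (piece A)) (⋁ (piece (∁ A))) outside piece-cover (−⁺ A∉D))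
        where
        outside : ∀ {x q} → x ∈ piece U → q ⊩ x → q ⊩ − ⋁ (piece A) → q ⊩ ⋁ (piece (∁ A))
        outside (k , _ , refl) q⊩δ q⊩− = ⋁⁺ (k , (λ k∈A → −⁻ q⊩− (⋁⁺ (k , k∈A , refl) q⊩δ)) , refl) q⊩δ

    -- A generating set would be empty: `n⊮δ` keeps each singleton out of D, so its complement
    -- belongs to D and excludes that index.
    nonprincipal : ¬ Principal D
    nonprincipal (X , generates) =
      IsUltrafilter.∅∉D isUltrafilter (Equivalence.from (generates ∅) λ {k} k∈X → X∌ k k∈X)
      where
      X∌ : ∀ k → ¬ k ∈ X
      X∌ k k∈X with IsUltrafilter.ultra isUltrafilter (_≡ k)
      ... | inj₁ k∈D = n⊮δ k (⋁⁻ ⊤ (δ k) (λ { (_ , refl , refl) q⊩ _ → q⊩ }) k∈D ⊩⊤)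
      ... | inj₂ k∉D = Equivalence.to (generates _) k∉D k∈X refl

  localReal : ¬ (Σ[ D ∈ Pred (Pred ℕ 0ℓ) 0ℓ ] (IsUltrafilter D × ¬ Principal D × NowhereDenseFilter D)) →
    ∃[ r ] (∀ {a} → n ⊩ a → SomewhereDense (trace r a))
  localReal none with ¬∀⇒∃¬ (λ nwd → none (D , isUltrafilter , nonprincipal , nwd))
  ... | f , nowhere = r , dense
    where
    r : ℕ → Carrier
    -- This name takes the constant value `f k` on the k-th cell.
    r i = ⋁ (piece λ k → f k i ≡ true)
    real-δ : ∀ {q} k → q ⊩ δ k → ∀ i → real r q i ≡ f k i
    real-δ {q} k q⊩δ i with f k i in eq
    ... | true = truth-true (⋁⁺ (k , eq , refl) q⊩δ)
    ... | false = truth-false λ q⊩r → ⊮⊥ (⋁⁻ (δ k) ⊥ other q⊩r q⊩δ)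
      where
      other : ∀ {x q} → x ∈ piece (λ k → f k i ≡ true) → q ⊩ x → q ⊩ δ k → q ⊩ ⊥
      other (j , eq′ , refl) q⊩j q⊩k with δ-unique q⊩j q⊩k
      ... | refl = case trans (sym eq) eq′ of λ ()
    dense : ∀ {a} → n ⊩ a → SomewhereDense (trace r a)
    dense {a} n⊩a with ¬sparse⇒somewhereDense (λ sparse → nowhere (A , A∈D , sparse⇒nowhereDense sparse))
      where
      A : Pred ℕ 0ℓ
      -- The cells that meet `a` cover it, so their indices form a set in D, on which `f` is
      -- somewhere dense.
      A k = ∃[ q ] (q ⊩ a × q ⊩ δ k)
      A∈D : A ∈ D
      A∈D = ⋁⁻ a (⋁ (piece A)) (λ { (k , _ , refl) q⊩δ q⊩a → ⋁⁺ (k , (_ , q⊩a , q⊩δ) , refl) q⊩δ })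
              piece-cover n⊩a
    ... | s , meets = s , λ w → trace-meets w (meets w)
      where
      trace-meets : ∀ w → ∃[ y ] (y ∈ image f (λ k → ∃[ q ] (q ⊩ a × q ⊩ δ k)) × Through y (w ++ s)) →
        ∃[ y ] (y ∈ trace r a × Through y (w ++ s))
      trace-meets w (y , (k , (q , q⊩a , q⊩δ) , f≗y) , y∋) =
        real r q , (q , q⊩a , refl) ,
        Nbhd-Through {y} {real r q} {w ++ s} (λ i _ → sym (trans (real-δ k q⊩δ i) (f≗y i))) y∋

-- Gluing the local names into a Cohen real.

module Glue (em : ∀ ℓ → ExcludedMiddle ℓ) {𝔸 : BooleanAlgebra 0ℓ 0ℓ} (ρ : Realization 𝔸 ℕ)
  (complete : Complete 𝔸) (r : ℕ → ℕ → BooleanAlgebra.Carrier 𝔸) where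

  open Classical em
  open Realization ρ
  open RealizationProperties em ρ
  open Sups em ρ complete
  open BooleanAlgebra 𝔸 using (Carrier; _∧_; ⊥) renaming (¬_ to −_)

  sparse-witness : ∀ n m → ∃[ x ] (Sparse (trace (r n) x) ×
    ((∃[ a ] (m ⊩ a × Sparse (trace (r n) a))) → m ⊩ x))
  sparse-witness n m with decide (∃[ a ] (m ⊩ a × Sparse (trace (r n) a)))
  ... | yes (a , m⊩a , sparse) = a , sparse , λ _ → m⊩a
  -- The default `⊥` is sparse because its trace is empty.
  ... | no none = ⊥ , (λ s → [] , λ { (_ , p⊩⊥ , _) → contradiction p⊩⊥ ⊮⊥ }) , λ a → contradiction a none

  open module Cells (n : ℕ) = Disjointify (proj₁ ∘ sparse-witness n)
    using () renaming (δ to cell; δ⇒x to cell⇒x; x⇒δ to x⇒cell; δ-unique to cell-unique)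

  cell-sparse : ∀ n k → Sparse (trace (r n) (cell n k))
  cell-sparse n k = sparse-⊆ (λ (p , p⊩ , eq) → p , cell⇒x n k p⊩ , eq) (proj₁ (proj₂ (sparse-witness n k)))

  rest : ℕ → Carrier
  rest n = − ⋁ (λ x → ∃[ k ] x ≡ cell n k)

  rest∌cell : ∀ {p n k} → p ⊩ rest n → ¬ p ⊩ cell n k
  rest∌cell p⊩rest p⊩cell = −⁻ p⊩rest (⋁⁺ (_ , refl) p⊩cell)

  -- From depth n on, the glued real follows r n on rest n; on the k-th cell it takes suc k bits
  -- from r n and leaves the remaining ones to depth suc n.
  data OneBit : ℕ → ℕ → Carrier → Set where
    now   : ∀ {n k i} → i ≤ k → OneBit n i (cell n k ∧ r n i)
    later : ∀ {n k i a} → OneBit (suc n) i a → OneBit n (i + suc k) (cell n k ∧ a)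
    stay  : ∀ {n i} → OneBit n i (rest n ∧ r n i)

  glued : ℕ → ℕ → Carrier
  glued n i = ⋁ (OneBit n i)

  glued-rest : ∀ {p} n → p ⊩ rest n → ∀ i → real (glued n) p i ≡ real (r n) p i
  glued-rest n p⊩ i = truth-cong (λ p⊩R → ⋁⁻ (rest n) (r n i) bit p⊩R p⊩) (λ p⊩r → ⋁⁺ stay (∧⁺ p⊩ p⊩r))
    where
    bit : ∀ {i x q} → OneBit n i x → q ⊩ x → q ⊩ rest n → q ⊩ r n i
    bit (now _) q⊩ q⊩rest = contradiction (proj₁ (∧⁻ q⊩)) (rest∌cell q⊩rest)
    bit (later _) q⊩ q⊩rest = contradiction (proj₁ (∧⁻ q⊩)) (rest∌cell q⊩rest)
    bit stay q⊩ _ = proj₂ (∧⁻ q⊩)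

  glued-now : ∀ {p} n {k i} → p ⊩ cell n k → i ≤ k → real (glued n) p i ≡ real (r n) p i
  glued-now n {k} {i} p⊩ i≤k =
    truth-cong (λ p⊩R → ⋁⁻ (cell n k) (r n i) (bit i≤k) p⊩R p⊩) (λ p⊩r → ⋁⁺ (now i≤k) (∧⁺ p⊩ p⊩r))
    where
    bit : ∀ {i x q} → i ≤ k → OneBit n i x → q ⊩ x → q ⊩ cell n k → q ⊩ r n i
    bit _ (now _) q⊩ _ = proj₂ (∧⁻ q⊩)
    -- A `later` bit of this cell has a position of at least `suc k`, beyond `i`.
    bit i≤k (later {k = k′} {i = i′} _) q⊩ q⊩cell with cell-unique n (proj₁ (∧⁻ q⊩)) q⊩cell
    ... | refl = contradiction (≤-trans (m≤n+m (suc k′) i′) i≤k) (<-irrefl refl)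
    bit _ stay q⊩ q⊩cell = contradiction q⊩cell (rest∌cell (proj₁ (∧⁻ q⊩)))

  glued-later : ∀ {p} n {k} → p ⊩ cell n k → ∀ i → real (glued n) p (i + suc k) ≡ real (glued (suc n)) p i
  glued-later n {k} p⊩ i = truth-cong
    (λ p⊩R → ⋁⁻ (cell n k) (glued (suc n) i) (λ x∈ → bit x∈ refl) p⊩R p⊩)
    (λ p⊩R → ⋁⁻ (cell n k) (glued n (i + suc k)) (λ x∈ q⊩x q⊩cell → ⋁⁺ (later x∈) (∧⁺ q⊩cell q⊩x)) p⊩R p⊩)
    where
    bit : ∀ {j x q} → OneBit n j x → j ≡ i + suc k → q ⊩ x → q ⊩ cell n k → q ⊩ glued (suc n) i
    bit (now {k = k′} j≤k) refl q⊩ q⊩cell with cell-unique n (proj₁ (∧⁻ q⊩)) q⊩cell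
    ... | refl = contradiction (≤-trans (m≤n+m (suc k′) i) j≤k) (<-irrefl refl)
    bit (later {k = k′} {i = i′} x∈) eq q⊩ q⊩cell with cell-unique n (proj₁ (∧⁻ q⊩)) q⊩cell
    ... | refl with +-cancelʳ-≡ (suc k′) i′ i eq
    ... | refl = ⋁⁺ x∈ (proj₂ (∧⁻ q⊩))
    bit stay _ q⊩ q⊩cell = contradiction q⊩cell (rest∌cell (proj₁ (∧⁻ q⊩)))

  module _ (dense-at : ∀ n {a} → n ⊩ a → SomewhereDense (trace (r n) a)) where

    -- Passing from `a` to `b` fixes the first `suc k` bits on the cell to be `u`. What follows is
    -- the real of depth `suc n`, so density of its trace below `s` becomes density below `s ++ u`.
    dense-in-cell : ∀ {p a} n k → p ⊩ cell n k →
      (∀ {b} → p ⊩ b → SomewhereDense (trace (glued (suc n)) b)) → p ⊩ a → SomewhereDense (trace (glued n) a)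
    dense-in-cell {p} {a} n k p⊩cell next p⊩a = s ++ u , λ w → extend w (dense w)
      where
      u : List Bool
      u = restrict (real (r n) p) (suc k)
      b : Carrier
      b = a ∧ (cell n k ∧ cylinder (r n) u)
      IH : SomewhereDense (trace (glued (suc n)) b)
      IH = next (∧⁺ p⊩a (∧⁺ p⊩cell (Through⇒cylinder u (restrict-Through (real (r n) p) (suc k)))))
      s : List Bool
      s = proj₁ IH
      dense : ∀ w → ∃[ y ] (y ∈ trace (glued (suc n)) b × Through y (w ++ s))
      dense = proj₂ IH
      |u| : length u ≡ suc k
      |u| = length-restrict (real (r n) p) (suc k)
      extend : ∀ w → ∃[ y ] (y ∈ trace (glued (suc n)) b × Through y (w ++ s)) →
        ∃[ y ] (y ∈ trace (glued n) a × Through y (w ++ (s ++ u)))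
      extend w (_ , (q , q⊩b , refl) , q∋) with ∧⁻ q⊩b
      ... | q⊩a , q⊩cu with ∧⁻ q⊩cu
      ... | q⊩cell , q⊩u = real (glued n) q , (q , q⊩a , refl) ,
        subst (Through (real (glued n) q)) (++-assoc w s u)
          (Through-++ u (w ++ s)
            (Nbhd-Through {real (r n) q} {real (glued n) q} {u}
              (λ i i<|u| → sym (glued-now n q⊩cell (≤-pred (subst (i <_) |u| i<|u|))))
              (cylinder⇒Through u q⊩u))
            (λ i → trans (cong (λ l → real (glued n) q (i + l)) |u|) (glued-later n q⊩cell i))
            q∋)

    -- The element `a` is not sparse for `r n`, since p would otherwise lie in a cell. Density of
    -- its `r n`-trace passes to the glued real, as every `w ++ s` can be realised either on
    -- `rest n` or in a cell late enough to keep all these bits.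
    dense-outside-cells : ∀ {p a} n → (∀ k → ¬ p ⊩ cell n k) → p ⊩ a → SomewhereDense (trace (glued n) a)
    dense-outside-cells {p} {a} n p⊮cell p⊩a
      with ¬sparse⇒somewhereDense not-sparse
      where
      not-sparse : ¬ Sparse (trace (r n) a)
      not-sparse sparse =
        let (k , p⊩cell) = x⇒cell n p (proj₂ (proj₂ (sparse-witness n p)) (a , p⊩a , sparse)) in p⊮cell k p⊩cell
    ... | s , dense = s , λ w → meet w
      where
      meet : ∀ w → ∃[ y ] (y ∈ trace (glued n) a × Through y (w ++ s))
      -- The extension `w′` avoids the finitely many cells with index below `length (w ++ s)`, which
      -- might keep too few bits of `r n`.
      meet w with sparse-finite (cell-sparse n) (length (w ++ s)) (w ++ s)
      ... | w′ , avoid with dense (w′ ++ w)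
      ... | _ , (q , q⊩a , refl) , q∋₀ with subst (Through (real (r n) q)) (++-assoc w′ w s) q∋₀
      ... | q∋ with decide (∃[ k ] (∃[ q′ ] (q′ ⊩ cell n k × q′ ⊩ a ∧ cylinder (r n) (w′ ++ (w ++ s)))))
      ... | no none = real (glued n) q , (q , q⊩a , refl) ,
        Nbhd-Through {real (r n) q} {real (glued n) q} {w ++ s} (λ i _ → sym (glued-rest n q⊩rest i))
          (Through-suffix w′ q∋)
        where
        z : Carrier
        z = a ∧ cylinder (r n) (w′ ++ (w ++ s))
        q⊩rest : q ⊩ rest n
        q⊩rest = −⁺ λ q⊩⋁ → ⊮⊥ (⋁⁻ z ⊥ (λ { (k , refl) q′⊩cell q′⊩z → contradiction (k , _ , q′⊩cell , q′⊩z) none })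
          q⊩⋁ (∧⁺ q⊩a (Through⇒cylinder (w′ ++ (w ++ s)) q∋)))
      ... | yes (k , q′ , q′⊩cell , q′⊩z) with ∧⁻ q′⊩z
      ... | q′⊩a , q′⊩cyl with cylinder⇒Through (w′ ++ (w ++ s)) q′⊩cyl
      ... | q′∋ = real (glued n) q′ , (q′ , q′⊩a , refl) ,
        Nbhd-Through {real (r n) q′} {real (glued n) q′} {w ++ s}
          (λ i i<l → sym (glued-now n q′⊩cell (≤-trans (<⇒≤ i<l) l≤k))) (Through-suffix w′ q′∋)
        where
        l≤k : length (w ++ s) ≤ k
        l≤k = ≮⇒≥ λ k<l → avoid k<l (q′ , q′⊩cell , refl) q′∋

    -- The ultrafilter n has no element with sparse r n-trace, so it lies in no cell of depth n:
    -- the ultrafilter k + n stops at the latest after k steps.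
    glued-dense : ∀ k n {p a} → p ≡ k + n → p ⊩ a → SomewhereDense (trace (glued n) a)
    glued-dense k n {p} p≡ p⊩a with decide (∃[ j ] p ⊩ cell n j)
    ... | no none = dense-outside-cells n (λ j p⊩ → none (j , p⊩)) p⊩a
    glued-dense zero n refl p⊩a | yes (j , p⊩cell) =
      contradiction (dense-at n p⊩cell) (sparse⇒¬somewhereDense (cell-sparse n j))
    glued-dense (suc k) n p≡ p⊩a | yes (j , p⊩cell) =
      dense-in-cell n j p⊩cell (glued-dense k (suc n) (trans p≡ (sym (+-suc k n)))) p⊩a

    glued-cohen : Cohen (glued 0)
    glued-cohen {p = p} = glued-dense p 0 (sym (+-identityʳ p))

-- The algebra of clopen sets of finite sequences.

T-not⁺ : ∀ {b} → ¬ T b → T (not b)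
T-not⁺ {true} ¬t = ¬t _
T-not⁺ {false} _ = _

T-not⁻ : ∀ {b} → T (not b) → ¬ T b
T-not⁻ {false} _ ()

-- In the space of finite sequences of naturals (most recent entry first) whose open sets V satisfy
-- s ∈ V → {n | n ∷ s ∈ V} ∈ D, closures of open sets are open because D is ultra.
module ClopenAlgebra (em : ∀ ℓ → ExcludedMiddle ℓ) (D : Pred (Pred ℕ 0ℓ) 0ℓ) (ultrafilter : IsUltrafilter D) where

  open Classical em
  open IsUltrafilter ultrafilter

  D-disjoint : ∀ {A B} → A ∈ D → B ∈ D → ¬ (∀ n → n ∈ A → ¬ n ∈ B)
  D-disjoint A∈D B∈D disjoint = ∅∉D (upward (λ {n} (n∈A , n∈B) → disjoint n n∈A n∈B) (∩-closed A∈D B∈D))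

  D-nonempty : ∀ {A} → A ∈ D → ∃ A
  D-nonempty A∈D = by-contradiction λ empty → D-disjoint A∈D U∈D λ n n∈A _ → empty (n , n∈A)

  D-∁ : ∀ {A} → ¬ A ∈ D → ∁ A ∈ D
  D-∁ {A} A∉D = [ (λ A∈D → contradiction A∈D A∉D) , id ]′ (ultra A)

  -- The forward implication says that P is open; as D is ultra, the converse says the same of its
  -- complement.
  Clopen : Pred (List ℕ) 0ℓ → Set
  Clopen P = ∀ s → P s ⇔ (λ n → P (n ∷ s)) ∈ D

  Element : Set
  Element = Σ[ V ∈ (List ℕ → Bool) ] Clopen (T ∘ V)

  infix 4 _⊩_

  _⊩_ : List ℕ → Element → Set
  s ⊩ (V , _) = T (V s)

  element : ∀ {P} → Clopen P → Element
  element {P} clopen = truth ∘ P , λ s → mk⇔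
    (λ t → upward truth⁺ (Equivalence.to (clopen s) (truth⁻ t)))
    (λ d → truth⁺ (Equivalence.from (clopen s) (upward truth⁻ d)))

  private

    infix 8 −_
    infixr 7 _∧_
    infixr 6 _∨_

    _∧_ : Element → Element → Element
    (V , V-clopen) ∧ (W , W-clopen) = (λ s → V s Bool.∧ W s) , λ s → mk⇔
      (λ t → let (t₁ , t₂) = Equivalence.to T-∧ t in
        upward (Equivalence.from T-∧) (∩-closed (Equivalence.to (V-clopen s) t₁) (Equivalence.to (W-clopen s) t₂)))
      (λ d → Equivalence.from T-∧
        ( Equivalence.from (V-clopen s) (upward (λ {n} → proj₁ ∘ Equivalence.to (T-∧ {V (n ∷ s)})) d)
        , Equivalence.from (W-clopen s) (upward (λ {n} → proj₂ ∘ Equivalence.to (T-∧ {V (n ∷ s)})) d)))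

    −_ : Element → Element
    − (V , V-clopen) = not ∘ V , λ s → mk⇔
      (λ t → upward T-not⁺ (D-∁ λ d → T-not⁻ t (Equivalence.from (V-clopen s) d)))
      (λ d → T-not⁺ λ t → D-disjoint (Equivalence.to (V-clopen s) t) d λ n t t′ → T-not⁻ t′ t)

    _∨_ : Element → Element → Element
    (V , V-clopen) ∨ (W , W-clopen) = (λ s → V s Bool.∨ W s) , λ s → mk⇔
      (λ t → [ (λ t₁ → upward (λ {n} → Equivalence.from (T-∨ {V (n ∷ s)}) ∘ inj₁) (Equivalence.to (V-clopen s) t₁))
             , (λ t₂ → upward (λ {n} → Equivalence.from (T-∨ {V (n ∷ s)}) ∘ inj₂) (Equivalence.to (W-clopen s) t₂)) ]′
             (Equivalence.to (T-∨ {V s}) t))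
      (from s)
      where
      from : ∀ s → (λ n → T (V (n ∷ s) Bool.∨ W (n ∷ s))) ∈ D → T (V s Bool.∨ W s)
      from s d with ultra (λ n → T (V (n ∷ s)))
      ... | inj₁ d₁ = Equivalence.from (T-∨ {V s}) (inj₁ (Equivalence.from (V-clopen s) d₁))
      ... | inj₂ d₁ = Equivalence.from (T-∨ {V s}) (inj₂ (Equivalence.from (W-clopen s)
        (upward (λ {n} (¬t , t) → [ (λ t₁ → contradiction t₁ ¬t) , id ]′ (Equivalence.to (T-∨ {V (n ∷ s)}) t))
          (∩-closed d₁ d))))

  𝔸 : BooleanAlgebra 0ℓ 0ℓ
  𝔸 = record
    { Carrier = Element
    ; _≈_ = λ (V , _) (W , _) → V ≗ W
    ; _∨_ = _∨_
    ; _∧_ = _∧_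
    ; ¬_ = −_
    ; ⊤ = (λ _ → true) , λ s → mk⇔ (λ _ → upward _ U∈D) _
    ; ⊥ = (λ _ → false) , λ s → mk⇔ (λ ()) ∅∉D
    ; isBooleanAlgebra = record
      { isDistributiveLattice = record
        { isLattice = record
          { isEquivalence = record
            { refl = λ _ → refl
            ; sym = λ p s → sym (p s)
            ; trans = λ p q s → trans (p s) (q s)
            }
          ; ∨-comm = λ (V , _) (W , _) s → Boolₚ.∨-comm (V s) (W s)
          ; ∨-assoc = λ (V , _) (W , _) (X , _) s → Boolₚ.∨-assoc (V s) (W s) (X s)
          ; ∨-cong = λ p q s → cong₂ Bool._∨_ (p s) (q s)
          ; ∧-comm = λ (V , _) (W , _) s → Boolₚ.∧-comm (V s) (W s)
          ; ∧-assoc = λ (V , _) (W , _) (X , _) s → Boolₚ.∧-assoc (V s) (W s) (X s)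
          ; ∧-cong = λ p q s → cong₂ Bool._∧_ (p s) (q s)
          ; absorptive = (λ (V , _) (W , _) s → Boolₚ.∨-abs-∧ (V s) (W s))
                       , (λ (V , _) (W , _) s → Boolₚ.∧-abs-∨ (V s) (W s))
          }
        ; ∨-distrib-∧ = (λ (V , _) (W , _) (X , _) s → Boolₚ.∨-distribˡ-∧ (V s) (W s) (X s))
                      , (λ (V , _) (W , _) (X , _) s → Boolₚ.∨-distribʳ-∧ (V s) (W s) (X s))
        ; ∧-distrib-∨ = (λ (V , _) (W , _) (X , _) s → Boolₚ.∧-distribˡ-∨ (V s) (W s) (X s))
                      , (λ (V , _) (W , _) (X , _) s → Boolₚ.∧-distribʳ-∨ (V s) (W s) (X s))
        }
      ; ∨-complement = (λ (V , _) s → Boolₚ.∨-inverseˡ (V s)) , (λ (V , _) s → Boolₚ.∨-inverseʳ (V s))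
      ; ∧-complement = (λ (V , _) s → Boolₚ.∧-inverseˡ (V s)) , (λ (V , _) s → Boolₚ.∧-inverseʳ (V s))
      ; ¬-cong = λ p s → cong not (p s)
      }
    }

  open BooleanAlgebra 𝔸 using (⊤; ⊥)

  ρ : Realization 𝔸 (List ℕ)
  ρ = record
    { _⊩_ = _⊩_
    ; ⊩-resp = λ {s} x≈y → subst T (x≈y s)
    ; ⊩-∧ = T-∧
    ; ⊩-− = mk⇔ T-not⁻ T-not⁺
    ; ⊩-full = λ {x} x≉⊥ → by-contradiction λ empty → x≉⊥ λ s →
        ¬-not λ eq → empty (s , subst T (sym eq) _)
    }

  open RealizationProperties em ρ

  nontrivial : Nontrivial 𝔸
  nontrivial = ⊩⇒≉⊥ {[]} {⊤} _

  -- The topological closure, generated from below: a point whose successors belong to it D-almost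
  -- always is added. Boolean-valued `A` keep the type in `Set`.
  data Closure (O : Pred (List ℕ) 0ℓ) : Pred (List ℕ) 0ℓ where
    base : ∀ {s} → O s → Closure O s
    step : ∀ {s} (A : ℕ → Bool) → (T ∘ A) ∈ D → (∀ n → T (A n) → Closure O (n ∷ s)) → Closure O s

  closure-clopen : ∀ {O} → (∀ {s} → O s → (λ n → O (n ∷ s)) ∈ D) → Clopen (Closure O)
  closure-clopen {O} open′ s = mk⇔ to λ d → step (λ n → truth (Closure O (n ∷ s))) (upward truth⁺ d) λ n → truth⁻
    where
    to : Closure O s → (λ n → Closure O (n ∷ s)) ∈ D
    to (base s∈O) = upward base (open′ s∈O)
    to (step A A∈D sub) = upward (λ {n} → sub n) A∈D

  closure-⊩ : ∀ {O x} → (∀ {s} → O s → s ⊩ x) → ∀ {s} → Closure O s → s ⊩ x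
  closure-⊩ sub (base s∈O) = sub s∈O
  closure-⊩ {x = x} sub {s} (step A A∈D sub′) =
    Equivalence.from (proj₂ x s) (upward (λ {n} n∈A → closure-⊩ {x = x} sub (sub′ n n∈A)) A∈D)

  closureElement : ∀ (O : Pred (List ℕ) 0ℓ) → (∀ {s} → O s → (λ n → O (n ∷ s)) ∈ D) →
    ∃[ V ] ((∀ {s} → O s → s ⊩ V) × (∀ x → (∀ {s} → O s → s ⊩ x) → ∀ {s} → s ⊩ V → s ⊩ x))
  closureElement O O-open = element (closure-clopen O-open) ,
    (λ s∈O → truth⁺ (base s∈O)) , λ x sub s⊩ → closure-⊩ {x = x} sub (truth⁻ s⊩)

  -- The union of X is open, and its closure is the least clopen set containing it.
  complete : Complete 𝔸
  complete X = sup , record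
    { member = _
    ; upper = λ {x} x∈X → ⊩⇒⊴ {x} {sup} λ s s⊩x → proj₁ (proj₂ closed) (x , x∈X , s⊩x)
    ; least = λ {b} _ bound → ⊩⇒⊴ {sup} {b} λ s →
        proj₂ (proj₂ closed) b λ (x , x∈X , s⊩x) → ⊩-mono {x = x} {b} (bound x∈X) s⊩x
    }
    where
    O : Pred (List ℕ) 0ℓ
    O s = ∃[ x ] (x ∈ X × s ⊩ x)
    closed : ∃[ V ] ((∀ {s} → O s → s ⊩ V) × (∀ x → (∀ {s} → O s → s ⊩ x) → ∀ {s} → s ⊩ V → s ⊩ x))
    closed = closureElement O λ (x , x∈X , s⊩x) →
      upward (λ t → x , x∈X , t) (Equivalence.to (proj₂ x _) s⊩x)
    sup : Element
    sup = proj₁ closed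

  σ-centered : σ-Centered 𝔸
  σ-centered = (λ n x → to n ⊩ x) , centered , λ x → mk⇔
    (λ x≉⊥ → let (s , s⊩x) = Realization.⊩-full ρ {x} x≉⊥ in to⁻ s , subst (_⊩ x) (sym (to∘to⁻ s)) s⊩x)
    (λ (n , n⊩x) → ⊩⇒≉⊥ {to n} {x} n⊩x)
    where
    open Surjection (↠List (↠-id ℕ)) using (to; to⁻; to∘to⁻)
    meet : ∀ {s} xs → All (s ⊩_) xs → s ⊩ foldr _∧_ ⊤ xs
    meet [] [] = _
    meet (x ∷ xs) (s⊩x ∷ all) = ∧⁺ {x = x} {foldr _∧_ ⊤ xs} s⊩x (meet xs all)
    centered : ∀ n → Centered 𝔸 (to n ⊩_)
    centered n xs all = ⊩⇒≉⊥ {to n} {foldr _∧_ ⊤ xs} (meet xs all)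

  module _ (nonprincipal : ¬ Principal D) where

    singleton∉D : ∀ k → ¬ (_≡ k) ∈ D
    singleton∉D k k∈D = nonprincipal ((_≡ k) , λ A → mk⇔
      (λ { A∈D {_} refl → by-contradiction λ k∉A → D-disjoint {A} {_≡ k} A∈D k∈D λ { _ n∈A refl → k∉A n∈A } })
      (λ (k⊆A : (_≡ k) ⊆ A) → upward {_≡ k} {A} k⊆A k∈D))

    Cone : List ℕ → Pred (List ℕ) 0ℓ
    Cone s t = ∃[ w ] t ≡ w ++ s

    -- A successor of `t` can lie in the cone without `t` only by being `s` itself, which happens
    -- for at most one `n`; D contains no singleton.
    cone-clopen : ∀ s → Clopen (Cone s)
    cone-clopen s t = mk⇔
      (λ (w , eq) → upward (λ {n} _ → n ∷ w , cong (n ∷_) eq) U∈D)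
      (λ d → let (n , t∈ , n≢) = D-nonempty (∩-closed d (D-∁ {_≡ first s} (singleton∉D (first s)))) in parent n≢ t∈)
      where
      first : List ℕ → ℕ
      first [] = 0
      first (k ∷ _) = k
      parent : ∀ {n} → n ≢ first s → Cone s (n ∷ t) → Cone s t
      parent n≢ (m ∷ w , eq) = w , ∷-injectiveʳ eq
      parent n≢ ([] , refl) = contradiction refl n≢

    atomless : Atomless 𝔸 U
    atomless a atom with Realization.⊩-full ρ {a} (IsAtom.nonzero atom)
    ... | s , s⊩a with D-nonempty (Equivalence.to (proj₂ a s) s⊩a)
    ... | n , n∷s⊩a
        with IsAtom.minimal atom {a ∧ element (cone-clopen (n ∷ s))} _
               (⊩⇒⊴ {a ∧ element (cone-clopen (n ∷ s))} {a} λ q → proj₁ ∘ ∧⁻ {q} {a} {element (cone-clopen (n ∷ s))})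
    ... | inj₁ ≈⊥ = ⊩⇒≉⊥ {n ∷ s} {a ∧ cone} (∧⁺ {n ∷ s} {a} {cone} n∷s⊩a (truth⁺ ([] , refl))) ≈⊥
      where
      cone : Element
      cone = element (cone-clopen (n ∷ s))
    ... | inj₂ ≈a with truth⁻ (proj₂ (∧⁻ {s} {a} {element (cone-clopen (n ∷ s))} (subst T (sym (≈a s)) s⊩a)))
    -- The cone above `n ∷ s` misses the shorter sequence `s`, so it cuts the supposed atom
    -- properly.
    ... | w , eq = <-irrefl (cong length eq) (subst (length s <_) (sym (length-++ w)) (m≤n+m (suc (length s)) (length w)))

-- An open set around the root with nowhere dense image.

bounded : (g : ℕ → ℕ) → ∀ j → ∃[ K ] (∀ {i} → i ≤ j → g i ≤ K)
bounded g zero = g zero , λ { z≤n → ≤-refl }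
bounded g (suc j) with bounded g j
... | K , below = K + g (suc j) , bound
  where
  bound : ∀ {i} → i ≤ suc j → g i ≤ K + g (suc j)
  bound i≤ with m≤n⇒m<n∨m≡n i≤
  ... | inj₁ (s≤s i≤j) = ≤-trans (below i≤j) (m≤m+n K _)
  ... | inj₂ refl = m≤n+m _ K

module SparseImage (em : ∀ ℓ → ExcludedMiddle ℓ)
  (D : Pred (Pred ℕ 0ℓ) 0ℓ) (ultrafilter : IsUltrafilter D) (nowhereDense : NowhereDenseFilter D)
  (h : List ℕ → Cantor) (h-continuous : ∀ s k → (λ n → h (n ∷ s) ∈ Nbhd (h s) k) ∈ D) where

  open Classical em
  open IsUltrafilter ultrafilter

  open Surjection (↠List (↠-id ℕ)) using () renaming (to to seq; to⁻ to code; to∘to⁻ to seq-code)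
  open Surjection (↠List ℕ↠Bool) using () renaming (to to string; to⁻ to string-code; to∘to⁻ to string-code-inverse)

  sparseSuccessors : ∀ s → ∃[ A ] (A ∈ D × Sparse (image (λ n → h (n ∷ s)) A))
  sparseSuccessors s = let (A , A∈D , nwd) = nowhereDense (λ n → h (n ∷ s)) in A , A∈D , nowhereDense⇒sparse nwd

  Successors : List ℕ → Pred Cantor 0ℓ
  Successors s = image (λ n → h (n ∷ s)) (proj₁ (sparseSuccessors s))

  abstract
    -- Only finitely many `s` are coded before `t`, so one extension of `t` misses all their sparse
    -- successor images; its first new bit disagrees with `h []`.
    avoidance : ∀ t → ∃[ w ] ((¬ Through (h []) (w ++ t)) ×
      (∀ s {z} → code s < string-code t → z ∈ Successors s → ¬ Through z (w ++ t)))
    avoidance t with sparse-finite {Successors ∘ seq} (λ k → proj₂ (proj₂ (sparseSuccessors (seq k))))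
                       (string-code t) (not (h [] (length t)) ∷ t)
    ... | w , avoid = w ++ (v ∷ []) , root , successors
      where
      v : Bool
      v = not (h [] (length t))
      assoc : ∀ {z} → Through z ((w ++ (v ∷ [])) ++ t) → Through z (w ++ (v ∷ t))
      assoc {z} = subst (Through z) (++-assoc w (v ∷ []) t)
      root : ¬ Through (h []) ((w ++ (v ∷ [])) ++ t)
      root ∋ = not-¬ refl (∷-injectiveˡ (Through-suffix w (assoc ∋)))
      successors : ∀ s {z} → code s < string-code t → z ∈ Successors s → ¬ Through z ((w ++ (v ∷ [])) ++ t)
      successors s {z} s<t z∈ z∋ = avoid s<t (subst (λ s → z ∈ Successors s) (sym (seq-code s)) z∈) (assoc z∋)

  _⁺ : List Bool → List Bool
  t ⁺ = proj₁ (avoidance t) ++ t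

  precision : ∀ s → ∃[ K ] (∀ {i} → i ≤ code s → length (string i ⁺) ≤ K)
  precision s = bounded (λ i → length (string i ⁺)) (code s)

  -- The first condition serves the strings coded after `s`, the second the finitely many others.
  Branching : List ℕ → Pred ℕ 0ℓ
  Branching s n = n ∈ proj₁ (sparseSuccessors s) × h (n ∷ s) ∈ Nbhd (h s) (proj₁ (precision s))

  data Tree : Pred (List ℕ) 0ℓ where
    root  : Tree []
    child : ∀ {s n} → Tree s → n ∈ Branching s → Tree (n ∷ s)

  Tree-open : ∀ {s} → Tree s → (λ n → Tree (n ∷ s)) ∈ D
  Tree-open {s} s∈ = upward (child s∈)
    (∩-closed (proj₁ (proj₂ (sparseSuccessors s))) (h-continuous s (proj₁ (precision s))))

  -- Of a parent s coded before t, all children avoid t ⁺ outright; children of any other s agree with s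
  -- on the length of t ⁺.
  Tree-avoids : ∀ t {s} → Tree s → ¬ Through (h s) (t ⁺)
  Tree-avoids t root = proj₁ (proj₂ (avoidance t))
  Tree-avoids t (child {s} {n} s∈ (n∈A , near)) ∋ with <-≤-connex (code s) (string-code t)
  ... | inj₁ s<t = proj₂ (proj₂ (avoidance t)) s s<t (n , n∈A , λ _ → refl) ∋
  ... | inj₂ t≤s = Tree-avoids t s∈ (Nbhd-Through {h (n ∷ s)} {h s} {t ⁺}
    (λ i i<l → sym (near i (<-≤-trans i<l length≤))) ∋)
    where
    length≤ : length (t ⁺) ≤ proj₁ (precision s)
    length≤ = subst (λ t → length (t ⁺) ≤ proj₁ (precision s)) (string-code-inverse t) (proj₂ (precision s) t≤s)

  Tree-sparse : Sparse (λ z → ∃[ s ] (Tree s × h s ≡ z))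
  Tree-sparse t = proj₁ (avoidance t) , λ { (s , s∈ , refl) → Tree-avoids t s∈ }

-- Countable atomless subalgebras are not regular.

module NoCountableRegularSubalgebra (em : ∀ ℓ → ExcludedMiddle ℓ)
  (D : Pred (Pred ℕ 0ℓ) 0ℓ) (ultrafilter : IsUltrafilter D) (nowhereDense : NowhereDenseFilter D)
  {𝔸 : BooleanAlgebra 0ℓ 0ℓ} (ρ : Realization 𝔸 (List ℕ))
  (elements-open : ∀ x {s} → Realization._⊩_ ρ s x → (λ n → Realization._⊩_ ρ (n ∷ s) x) ∈ D)
  (closure : ∀ (O : Pred (List ℕ) 0ℓ) → (∀ {s} → O s → (λ n → O (n ∷ s)) ∈ D) →
    ∃[ V ] ((∀ {s} → O s → Realization._⊩_ ρ s V) ×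
      (∀ x → (∀ {s} → O s → Realization._⊩_ ρ s x) → ∀ {s} → Realization._⊩_ ρ s V → Realization._⊩_ ρ s x))) where

  open Classical em
  open IsUltrafilter ultrafilter
  open Realization ρ
  open RealizationProperties em ρ
  open BooleanAlgebra 𝔸 using (Carrier; _≈_; _∧_; ⊤) renaming (¬_ to −_)
  open Poset (LatticeProperties.poset (BooleanAlgebra.lattice 𝔸)) using () renaming (_≤_ to _⊴_)

  module _ (B : Pred Carrier 0ℓ) (sub : IsSubalgebra 𝔸 B) (B-atomless : Atomless 𝔸 B)
    (e : ℕ → Carrier) (e∈B : ∀ n → e n ∈ B) (e-onto : ∀ {b} → b ∈ B → ∃[ n ] e n ≈ b) where

    open IsSubalgebra sub

    -- Splitting the nodes of depth n by e n where possible makes the tree dense in B.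
    Splits : Carrier → Carrier → Carrier → Set
    Splits x c y = y ∈ B × (∀ v → ∃[ q ] q ⊩ signed v y ∧ x) ×
      ((∃[ q ] (q ⊩ x × q ⊩ c)) → ∀ q → q ⊩ x → q ⊩ y → q ⊩ c)

    both-sides : ∀ x y → ∃[ q ] (q ⊩ x × q ⊩ y) → ∃[ q ] (q ⊩ x × ¬ q ⊩ y) → ∀ v → ∃[ q ] q ⊩ signed v y ∧ x
    both-sides x y (q , q⊩x , q⊩y) _ true = q , ∧⁺ q⊩y q⊩x
    both-sides x y _ (q , q⊩x , q⊮y) false = q , ∧⁺ (−⁺ q⊮y) q⊩x

    -- If `c` splits `x`, it is taken itself. Otherwise `x` is contained in `c` or disjoint from it,
    -- and any splitting of `x` within B will do.
    splitter : ∀ x c → x ∈ B → c ∈ B → ∃[ p ] p ⊩ x → ∃[ y ] Splits x c y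
    splitter x c x∈B c∈B (p , p⊩x) with decide ((∃[ q ] (q ⊩ x × q ⊩ c)) × (∃[ q ] (q ⊩ x × ¬ q ⊩ c)))
    ... | yes (inside , outside) = c , c∈B , both-sides x c inside outside , λ _ _ _ → id
    ... | no ¬both with atomless-split sub B-atomless x∈B p⊩x
    ... | y , y∈B , inside , outside = y , y∈B , both-sides x y inside outside ,
      λ meets q q⊩x _ → by-contradiction λ q⊮c → ¬both (meets , q , q⊩x , q⊮c)

    node : List Bool → Σ[ x ∈ Carrier ] (x ∈ B × ∃[ p ] p ⊩ x)

    split : ∀ s → ∃[ y ] Splits (proj₁ (node s)) (e (length s)) y
    split s = let (x , x∈B , p⊩x) = node s in splitter x (e (length s)) x∈B (e∈B _) p⊩x

    y : List Bool → Carrier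
    y s = proj₁ (split s)

    node [] = ⊤ , ⊤-closed , [] , ⊩⊤
    node (v ∷ s) = signed v (y s) ∧ proj₁ (node s) ,
      ∧-closed (signed-closed v) (proj₁ (proj₂ (node s))) , proj₁ (proj₂ (proj₂ (split s))) v
      where
      signed-closed : ∀ v → signed v (y s) ∈ B
      signed-closed true = proj₁ (proj₂ (split s))
      signed-closed false = −-closed (proj₁ (proj₂ (split s)))

    node≡cyl : ∀ s → proj₁ (node s) ≡ cyl y s
    node≡cyl [] = refl
    node≡cyl (v ∷ s) = cong (signed v (y s) ∧_) (node≡cyl s)

    path : List ℕ → ℕ → List Bool
    path p zero = []
    path p (suc i) = truth (p ⊩ y (path p i)) ∷ path p i

    -- The branch of the tree followed by a point; `path` records the node reached, on which the
    -- next bit depends.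
    h : List ℕ → Cantor
    h p i = truth (p ⊩ y (path p i))

    restrict≡path : ∀ p i → restrict (h p) i ≡ path p i
    restrict≡path p zero = refl
    restrict≡path p (suc i) = cong (h p i ∷_) (restrict≡path p i)

    h-tracks : ∀ {p} s → Through (h p) s → h p (length s) ≡ truth (p ⊩ y s)
    h-tracks {p} s p∋ = cong (λ t → truth (p ⊩ y t)) (trans (sym (restrict≡path p (length s))) p∋)

    cyl⇒h : ∀ {p} s → p ⊩ cyl y s → Through (h p) s
    cyl⇒h = cyl⇒Through y h h-tracks

    h⇒cyl : ∀ {p} s → Through (h p) s → p ⊩ cyl y s
    h⇒cyl = Through⇒cyl y h h-tracks

    cyl∈B : ∀ s → cyl y s ∈ B
    cyl∈B s = subst B (node≡cyl s) (proj₁ (proj₂ (node s)))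

    cyl-nonzero : ∀ s → ∃[ p ] p ⊩ cyl y s
    cyl-nonzero s = subst (λ x → ∃[ p ] p ⊩ x) (node≡cyl s) (proj₂ (proj₂ (node s)))

    -- With `b` enumerated as `e n`, the node `s` of depth `n` on the branch of p meets `b`, so the
    -- positive half of its split lies below `b`.
    cyl-below : ∀ {b p} → b ∈ B → p ⊩ b → ∃[ s ] (∀ q → q ⊩ cyl y s → q ⊩ b)
    cyl-below {b} {p} b∈B p⊩b = true ∷ s , below
      where
      n : ℕ
      n = proj₁ (e-onto b∈B)
      s : List Bool
      s = restrict (h p) n
      e⊩b : ∀ {q} → q ⊩ e (length s) → q ⊩ b
      e⊩b {q} = ⊩-resp (proj₂ (e-onto b∈B)) ∘ subst (λ m → q ⊩ e m) (length-restrict (h p) n)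
      b⊩e : ∀ {q} → q ⊩ b → q ⊩ e (length s)
      b⊩e {q} = subst (λ m → q ⊩ e m) (sym (length-restrict (h p) n)) ∘ ⊩-resp⁻ (proj₂ (e-onto b∈B))
      decided : ∀ q → q ⊩ proj₁ (node s) → q ⊩ y s → q ⊩ e (length s)
      decided = proj₂ (proj₂ (proj₂ (split s)))
        (p , subst (p ⊩_) (sym (node≡cyl s)) (h⇒cyl s (restrict-Through (h p) n)) , b⊩e p⊩b)
      below : ∀ q → q ⊩ cyl y (true ∷ s) → q ⊩ b
      below q q⊩ = let (q⊩y , q⊩s) = ∧⁻ q⊩ in
        e⊩b (decided q (subst (q ⊩_) (sym (node≡cyl s)) q⊩s) q⊩y)

    -- The cylinder of the first `k` bits of `h s` is an element containing `s`, hence contains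
    -- D-almost all successors of `s`.
    h-continuous : ∀ s k → (λ n → h (n ∷ s) ∈ Nbhd (h s) k) ∈ D
    h-continuous s k = upward
      (λ {n} n∷s⊩ → restrict⇒Nbhd k (trans (sym (cyl⇒h (restrict (h s) k) n∷s⊩))
        (cong (restrict (h (n ∷ s))) (length-restrict (h s) k))))
      (elements-open (cyl y (restrict (h s) k)) (h⇒cyl _ (restrict-Through (h s) k)))

    open SparseImage em D ultrafilter nowhereDense h h-continuous using (Tree; root; Tree-open; Tree-sparse)

    -- The members of B disjoint from `Tree` have supremum `⊤` in B: each nonzero member of B
    -- contains a cylinder, and by sparsity a smaller one that misses `Tree`. In the whole algebra
    -- `− V` is an upper bound, and it omits the root.
    not-regular : ¬ Regular 𝔸 B
    not-regular regular = −⁻ (⊩-mono (IsSup.least (regular X proj₁ sup) {− V} _ X-below) ⊩⊤) (Tree⊆V root)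
      where
      V : Carrier
      V = proj₁ (closure Tree Tree-open)
      Tree⊆V : ∀ {s} → Tree s → s ⊩ V
      Tree⊆V = proj₁ (proj₂ (closure Tree Tree-open))
      X : Pred Carrier 0ℓ
      X x = x ∈ B × (∀ {s} → Tree s → ¬ s ⊩ x)
      X-below : ∀ {x} → x ∈ X → x ⊴ − V
      X-below {x} (_ , disjoint) = ⊩⇒⊴ λ s s⊩x → −⁺ λ s⊩V →
        −⁻ (proj₂ (proj₂ (closure Tree Tree-open)) (− x) (λ s∈ → −⁺ (disjoint s∈)) s⊩V) s⊩x
      misses : ∀ {c} t → (∀ q → q ⊩ cyl y t → q ⊩ − c) → ¬ (∀ {x} → x ∈ X → x ⊴ c)
      misses {c} t t⊴−c bound = −⁻ (t⊴−c q (h⇒cyl t (Through-suffix w (cyl⇒h t′ q⊩)))) (⊩-mono (bound t′∈X) q⊩)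
        where
        w : List Bool
        w = proj₁ (Tree-sparse t)
        t′ : List Bool
        t′ = w ++ t
        q : List ℕ
        q = proj₁ (cyl-nonzero t′)
        q⊩ : q ⊩ cyl y t′
        q⊩ = proj₂ (cyl-nonzero t′)
        t′∈X : cyl y t′ ∈ X
        t′∈X = cyl∈B t′ , λ {s} s∈ s⊩ → proj₂ (Tree-sparse t) (s , s∈ , refl) (cyl⇒h t′ s⊩)
      sup : IsSup 𝔸 B X ⊤
      sup = ⊤-sup ⊤-closed λ {c} c∈B bound p → by-contradiction λ p⊮c →
        misses (proj₁ (cyl-below (−-closed c∈B) (−⁺ p⊮c))) (proj₂ (cyl-below (−-closed c∈B) (−⁺ p⊮c))) bound

  noCountableRegularSubalgebra : ¬ HasCountableRegularSubalgebra 𝔸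
  noCountableRegularSubalgebra (B , sub , B-atomless , (e , e∈B , e-onto) , regular) =
    not-regular B sub B-atomless e e∈B e-onto regular

theorem1 : (∀ ℓ → ExcludedMiddle ℓ) →
    (∀ a ℓ → AxiomOfChoice a ℓ) →
    (Σ[ 𝔸 ∈ BooleanAlgebra 0ℓ 0ℓ ]
    (Nontrivial 𝔸 × Atomless 𝔸 U × Complete 𝔸 × σ-Centered 𝔸 ×
    ¬ HasCountableRegularSubalgebra 𝔸))
    ⇔
    (Σ[ D ∈ Pred (Pred ℕ 0ℓ) 0ℓ ]
    (IsUltrafilter D × ¬ Principal D × NowhereDenseFilter D))
theorem1 em ac = mk⇔ ultrafilter algebra
  where
  open Classical em using (by-contradiction)
  ultrafilter : Σ[ 𝔸 ∈ BooleanAlgebra 0ℓ 0ℓ ]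
    (Nontrivial 𝔸 × Atomless 𝔸 U × Complete 𝔸 × σ-Centered 𝔸 × ¬ HasCountableRegularSubalgebra 𝔸) →
    Σ[ D ∈ Pred (Pred ℕ 0ℓ) 0ℓ ] (IsUltrafilter D × ¬ Principal D × NowhereDenseFilter D)
  ultrafilter (𝔸 , _ , atomless , complete , σ-centered , no-subalgebra) = by-contradiction λ none →
    no-subalgebra (CohenSubalgebra.hasCountableRegularSubalgebra em ρ _
      (Glue.glued-cohen em ρ complete (λ n → proj₁ (localReal n none)) (λ n → proj₂ (localReal n none))))
    where
    ρ : Realization 𝔸 ℕ
    ρ = ultrafilterRealization em ac σ-centered
    open LocalReal em ρ complete atomless using (localReal)
  algebra : Σ[ D ∈ Pred (Pred ℕ 0ℓ) 0ℓ ] (IsUltrafilter D × ¬ Principal D × NowhereDenseFilter D) →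
    Σ[ 𝔸 ∈ BooleanAlgebra 0ℓ 0ℓ ]
    (Nontrivial 𝔸 × Atomless 𝔸 U × Complete 𝔸 × σ-Centered 𝔸 × ¬ HasCountableRegularSubalgebra 𝔸)
  algebra (D , isUltrafilter , nonprincipal , nowhereDense) =
    𝔸 , nontrivial , atomless nonprincipal , complete , σ-centered ,
    NoCountableRegularSubalgebra.noCountableRegularSubalgebra em D isUltrafilter nowhereDense ρ
      (λ x {s} → Equivalence.to (proj₂ x s)) closureElement
    where open ClopenAlgebra em D isUltrafilter
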